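{- Let $\alpha>1$ be a real number. Then $\alpha\notin\mathcal{Z}^\star$ if and only if there are infinitely many integers $r\geq 1$ for which there exist integers $k_1\geq 2$, $k_2,\dots,k_r\geq 1$ such that $$\left|\alpha-\zeta^\star(k_1,\dots,k_r)\right|<\sum_{n_1\geq\cdots\geq n_r\geq n_{r+1}\geq 2}\frac{1}{n_1^{k_1}\cdots n_r^{k_r}\,n_{r+1}}.$$
   Context: For integers $r\geq 1$, $k_1\geq 2$ and $k_2,\dots,k_r\geq 1$, the multiple zeta-star value is $$\zeta^\star(k_1,\dots,k_r)=\sum_{n_1\geq\cdots\geq n_r\geq 1}\frac{1}{n_1^{k_1}\cdots n_r^{k_r}},$$ where the sum is over integers. $\mathcal{Z}^\star\subset\mathbb{R}$ denotes the set of all multiple zeta-star values (over all $r\geq1$ and all such $(k_1,\dots,k_r)$). The paper phrases the condition as: the inequality holds "for infinitely many $r,k_1,\dots,k_r$ with $r\to+\infty$", i.e. it has solutions with arbitrarily large $r$. The summation on the right-hand side is over integers $n_1\geq\cdots\geq n_{r+1}\geq 2$; it equals $\zeta^\star(k_1,\dots,k_r,1)-\zeta^\star(k_1,\dots,k_r)$. -}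

module Defs where

open import Data.Integer.Base as ℤ using (+_; -[1+_])
import Data.Integer.Properties as ℤP
open import Data.Nat.Base as ℕ using (ℕ; zero; suc; z≤n; s≤s)
import Data.Nat.Properties as ℕP
open import Data.Product.Base using (Σ-syntax; ∃-syntax; _×_; _,_)
open import Data.Rational.Base as ℚ using (ℚ; 0ℚ; 1ℚ; _/_)
import Data.Rational.Properties as ℚP
open import Data.Rational.Solver using (module +-*-Solver)
import Data.Rational.Unnormalised.Base as ℚᵘ
import Data.Rational.Unnormalised.Properties as ℚᵘP
open import Data.Sum.Base using (inj₁; inj₂)
open import Data.Vec.Base using (Vec; []; _∷_; _∷ʳ_)
open import Data.Vec.Relation.Unary.All using (All; []; _∷_)
open import Level using (0ℓ)
open import Relation.Binary.PropositionalEquality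
open import Relation.Unary using (Pred)
open +-*-Solver using (solve; _:+_; _:*_; _:-_; :-_; con; _:=_)

------------------------------------------------------------------------
-- Real numbers as Cauchy sequences of rationals, up to _≃_

IsCauchy : (ℕ → ℚ) → Set
IsCauchy x = ∀ ε → 0ℚ ℚ.< ε →
  ∃[ N ] ∀ m n → N ℕ.≤ m → N ℕ.≤ n → ℚ.∣ x m ℚ.- x n ∣ ℚ.< ε

record ℝ : Set where
  constructor mkℝ
  field
    seq    : ℕ → ℚ
    cauchy : IsCauchy seq

open ℝ public

infix 4 _≃_ _<_

_≃_ : ℝ → ℝ → Set
x ≃ y = ∀ ε → 0ℚ ℚ.< ε → ∃[ N ] ∀ n → N ℕ.≤ n → ℚ.∣ seq x n ℚ.- seq y n ∣ ℚ.< ε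

-- The sequences must eventually be separated by a fixed positive rational:
-- an eventual termwise strict inequality would also relate equal reals.
_<_ : ℝ → ℝ → Set
x < y = ∃[ ε ] 0ℚ ℚ.< ε × ∃[ N ] ∀ n → N ℕ.≤ n → seq x n ℚ.+ ε ℚ.≤ seq y n

1ℝ : ℝ
1ℝ = mkℝ (λ _ → 1ℚ) λ ε ε>0 → 0 , λ _ _ _ _ → ε>0

p-r≡[p-q]+[q-r] : ∀ p q r → p ℚ.- r ≡ (p ℚ.- q) ℚ.+ (q ℚ.- r)
p-r≡[p-q]+[q-r] = solve 3 (λ p q r → p :- r := (p :- q) :+ (q :- r)) refl

∣p-q∣≡∣q-p∣ : ∀ p q → ℚ.∣ p ℚ.- q ∣ ≡ ℚ.∣ q ℚ.- p ∣
∣p-q∣≡∣q-p∣ p q = trans (sym (ℚP.∣-p∣≡∣p∣ (p ℚ.- q)))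
  (cong ℚ.∣_∣ (solve 2 (λ p q → :- (p :- q) := q :- p) refl p q))

p≤∣p∣ : ∀ p → p ℚ.≤ ℚ.∣ p ∣
p≤∣p∣ p with ℚP.≤-total 0ℚ p
... | inj₁ 0≤p = ℚP.≤-reflexive (sym (ℚP.0≤p⇒∣p∣≡p 0≤p))
... | inj₂ p≤0 = ℚP.≤-trans p≤0 (ℚP.0≤∣p∣ p)

-p≤∣p∣ : ∀ p → ℚ.- p ℚ.≤ ℚ.∣ p ∣
-p≤∣p∣ p = subst (ℚ.- p ℚ.≤_) (ℚP.∣-p∣≡∣p∣ p) (p≤∣p∣ (ℚ.- p))

∣p∣-bound : ∀ {p b} → p ℚ.≤ b → ℚ.- p ℚ.≤ b → ℚ.∣ p ∣ ℚ.≤ b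
∣p∣-bound {p} {b} p≤b -p≤b with ℚP.∣p∣≡p∨∣p∣≡-p p
... | inj₁ eq = subst (ℚ._≤ b) (sym eq) p≤b
... | inj₂ eq = subst (ℚ._≤ b) (sym eq) -p≤b

∣p∣-∣q∣≤∣p-q∣ : ∀ p q → ℚ.∣ p ∣ ℚ.- ℚ.∣ q ∣ ℚ.≤ ℚ.∣ p ℚ.- q ∣
∣p∣-∣q∣≤∣p-q∣ p q = begin
  ℚ.∣ p ∣ ℚ.- ℚ.∣ q ∣                           ≡⟨ cong (λ z → ℚ.∣ z ∣ ℚ.- ℚ.∣ q ∣) (lem p q) ⟩
  ℚ.∣ (p ℚ.- q) ℚ.+ q ∣ ℚ.- ℚ.∣ q ∣             ≤⟨ ℚP.+-monoˡ-≤ (ℚ.- ℚ.∣ q ∣) (ℚP.∣p+q∣≤∣p∣+∣q∣ (p ℚ.- q) q) ⟩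
  (ℚ.∣ p ℚ.- q ∣ ℚ.+ ℚ.∣ q ∣) ℚ.- ℚ.∣ q ∣       ≡⟨ solve 2 (λ a b → (a :+ b) :- b := a) refl ℚ.∣ p ℚ.- q ∣ ℚ.∣ q ∣ ⟩
  ℚ.∣ p ℚ.- q ∣                                 ∎
  where
  open ℚP.≤-Reasoning
  lem : ∀ p q → p ≡ (p ℚ.- q) ℚ.+ q
  lem = solve 2 (λ p q → p := (p :- q) :+ q) refl

∣∣p∣-∣q∣∣≤∣p-q∣ : ∀ p q → ℚ.∣ ℚ.∣ p ∣ ℚ.- ℚ.∣ q ∣ ∣ ℚ.≤ ℚ.∣ p ℚ.- q ∣
∣∣p∣-∣q∣∣≤∣p-q∣ p q = ∣p∣-bound (∣p∣-∣q∣≤∣p-q∣ p q)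
  (subst₂ ℚ._≤_ (solve 2 (λ a b → b :- a := :- (a :- b)) refl ℚ.∣ p ∣ ℚ.∣ q ∣)
    (∣p-q∣≡∣q-p∣ q p) (∣p∣-∣q∣≤∣p-q∣ q p))

infixl 6 _-_

_-_ : ℝ → ℝ → ℝ
x - y = mkℝ (λ n → seq x n ℚ.- seq y n) cau
  where
  cau : IsCauchy (λ n → seq x n ℚ.- seq y n)
  cau ε ε>0 with cauchy x (ε ℚ.* ℚ.½) (half>0 ε ε>0) | cauchy y (ε ℚ.* ℚ.½) (half>0 ε ε>0)
    where
    half>0 : ∀ ε → 0ℚ ℚ.< ε → 0ℚ ℚ.< ε ℚ.* ℚ.½
    half>0 ε ε>0 = subst (ℚ._< ε ℚ.* ℚ.½) (ℚP.*-zeroˡ ℚ.½) (ℚP.*-monoˡ-<-pos ℚ.½ ε>0)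
  ... | M , hx | N , hy = M ℕ.⊔ N , λ m n M⊔N≤m M⊔N≤n → begin-strict
    ℚ.∣ (seq x m ℚ.- seq y m) ℚ.- (seq x n ℚ.- seq y n) ∣
      ≡⟨ cong ℚ.∣_∣ (lem (seq x m) (seq y m) (seq x n) (seq y n)) ⟩
    ℚ.∣ (seq x m ℚ.- seq x n) ℚ.- (seq y m ℚ.- seq y n) ∣
      ≤⟨ ℚP.∣p-q∣≤∣p∣+∣q∣ (seq x m ℚ.- seq x n) (seq y m ℚ.- seq y n) ⟩
    ℚ.∣ seq x m ℚ.- seq x n ∣ ℚ.+ ℚ.∣ seq y m ℚ.- seq y n ∣
      <⟨ ℚP.+-mono-< (hx m n (ℕP.≤-trans (ℕP.m≤m⊔n M N) M⊔N≤m) (ℕP.≤-trans (ℕP.m≤m⊔n M N) M⊔N≤n))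
                     (hy m n (ℕP.≤-trans (ℕP.m≤n⊔m M N) M⊔N≤m) (ℕP.≤-trans (ℕP.m≤n⊔m M N) M⊔N≤n)) ⟩
    ε ℚ.* ℚ.½ ℚ.+ ε ℚ.* ℚ.½
      ≡⟨ trans (sym (ℚP.*-distribˡ-+ ε ℚ.½ ℚ.½)) (ℚP.*-identityʳ ε) ⟩
    ε ∎
    where
    open ℚP.≤-Reasoning
    lem : ∀ a b c d → (a ℚ.- b) ℚ.- (c ℚ.- d) ≡ (a ℚ.- c) ℚ.- (b ℚ.- d)
    lem = solve 4 (λ a b c d → (a :- b) :- (c :- d) := (a :- c) :- (b :- d)) refl

∣_∣ : ℝ → ℝ
∣ x ∣ = mkℝ (λ n → ℚ.∣ seq x n ∣) λ ε ε>0 →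
  let N , h = cauchy x ε ε>0 in
  N , λ m n N≤m N≤n → ℚP.≤-<-trans (∣∣p∣-∣q∣∣≤∣p-q∣ (seq x m) (seq x n)) (h m n N≤m N≤n)

------------------------------------------------------------------------
-- Truncated multiple zeta-star sums

∑ : ℕ → (ℕ → ℚ) → ℚ
∑ zero    f = 0ℚ
∑ (suc N) f = ∑ N f ℚ.+ f N

-- 1 / (1 + n) ^ k
weight : ℕ → ℕ → ℚ
weight n k = (+ 1 / (suc n ℕ.^ k)) {{ℕP.m^n≢0 (suc n) k}}

-- partialSum l (k₁ ∷ … ∷ kᵣ) N is the sum of 1 / (n₁ ^ k₁ ⋯ nᵣ ^ kᵣ) over
-- l + N ≥ n₁ ≥ ⋯ ≥ nᵣ ≥ l + 1.  The outermost variable is n₁ = suc (l + i)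
-- with i < N, and then l + suc i is the upper limit for n₂.
partialSum : ∀ {r} → ℕ → Vec ℕ r → ℕ → ℚ
partialSum l []       N = 1ℚ
partialSum l (k ∷ ks) N = ∑ N λ i → weight (l ℕ.+ i) k ℚ.* partialSum l ks (suc i)

-- The empty vector is not admissible, so r ≥ 1 is implied.
data Admissible : ∀ {r} → Vec ℕ r → Set where
  _∷_ : ∀ {r k} {ks : Vec ℕ r} → 2 ℕ.≤ k → All (1 ℕ.≤_) ks → Admissible (k ∷ ks)

------------------------------------------------------------------------
-- Convergence.  With q n = ∏_{m=1}^{n} 2m/(2m+1) and p n = (2n+1) q n, so that
-- p (n+1) - p n = q n, a sum of depth r with all exponents ≥ 1 is at most
-- 2^r p, and for k₁ ≥ 2 its increments are at most a constant multiple of the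
-- decrements of q, while q n ≤ 1/√(n+1) tends to 0.

module Convergence where

  ι : ℕ → ℚ
  ι n = + n / 1

  u : ℕ → ℚ
  u n = + 1 / suc n

  ι-suc : ∀ n → ι (suc n) ≡ 1ℚ ℚ.+ ι n
  ι-suc n = ℚP.toℚᵘ-injective (ℚᵘP.≃-trans (ℚP.toℚᵘ-fromℚᵘ (ℚᵘ.mkℚᵘ (+ suc n) 0))
    (ℚᵘP.≃-sym (ℚᵘP.≃-trans (ℚP.toℚᵘ-homo-+ 1ℚ (ι n))
      (ℚᵘP.≃-trans (ℚᵘP.+-congʳ ℚᵘ.1ℚᵘ (ℚP.toℚᵘ-fromℚᵘ (ℚᵘ.mkℚᵘ (+ n) 0)))
        (ℚᵘ.*≡* (cong (ℤ._* + 1) (cong (ℤ._+_ (+ 1)) (ℤP.*-identityʳ (+ n)))))))))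

  ι-+ : ∀ m n → ι (m ℕ.+ n) ≡ ι m ℚ.+ ι n
  ι-+ zero    n = sym (ℚP.+-identityˡ (ι n))
  ι-+ (suc m) n = begin
    ι (suc (m ℕ.+ n))          ≡⟨ ι-suc (m ℕ.+ n) ⟩
    1ℚ ℚ.+ ι (m ℕ.+ n)         ≡⟨ cong (1ℚ ℚ.+_) (ι-+ m n) ⟩
    1ℚ ℚ.+ (ι m ℚ.+ ι n)       ≡⟨ sym (ℚP.+-assoc 1ℚ (ι m) (ι n)) ⟩
    (1ℚ ℚ.+ ι m) ℚ.+ ι n       ≡⟨ cong (ℚ._+ ι n) (sym (ι-suc m)) ⟩
    ι (suc m) ℚ.+ ι n          ∎
    where open ≡-Reasoning

  0≤ι : ∀ n → 0ℚ ℚ.≤ ι n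
  0≤ι n = ℚP.nonNegative⁻¹ (ι n) {{ℚP.normalize-nonNeg n 1}}

  u-ι : ∀ n → u n ℚ.* ι (suc n) ≡ 1ℚ
  u-ι n = ℚP.toℚᵘ-injective (ℚᵘP.≃-trans (ℚP.toℚᵘ-homo-* (u n) (ι (suc n)))
    (ℚᵘP.≃-trans (ℚᵘP.*-cong (ℚP.toℚᵘ-fromℚᵘ (ℚᵘ.mkℚᵘ (+ 1) n)) (ℚP.toℚᵘ-fromℚᵘ (ℚᵘ.mkℚᵘ (+ suc n) 0)))
      (ℚᵘ.*≡* (trans (ℤP.*-identityʳ (+ 1 ℤ.* + suc n))
        (trans (ℤP.*-identityˡ (+ suc n)) (sym (trans (ℤP.*-identityˡ (+ (suc n ℕ.* 1))) (cong +_ (ℕP.*-identityʳ (suc n))))))))))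

  0≤u : ∀ n → 0ℚ ℚ.≤ u n
  0≤u n = ℚP.nonNegative⁻¹ (u n) {{ℚP.normalize-nonNeg 1 (suc n)}}

  0≤* : ∀ {p q} → 0ℚ ℚ.≤ p → 0ℚ ℚ.≤ q → 0ℚ ℚ.≤ p ℚ.* q
  0≤* {p} {q} 0≤p 0≤q = subst (ℚ._≤ p ℚ.* q) (ℚP.*-zeroʳ p)
    (ℚP.*-monoˡ-≤-nonNeg p {{ℚ.nonNegative 0≤p}} 0≤q)

  0≤+ : ∀ {p q} → 0ℚ ℚ.≤ p → 0ℚ ℚ.≤ q → 0ℚ ℚ.≤ p ℚ.+ q
  0≤+ {p} {q} 0≤p 0≤q = subst (ℚ._≤ p ℚ.+ q) (ℚP.+-identityˡ 0ℚ) (ℚP.+-mono-≤ 0≤p 0≤q)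

  *-mono-≤ : ∀ {a b c d} → 0ℚ ℚ.≤ a → 0ℚ ℚ.≤ d → a ℚ.≤ b → c ℚ.≤ d → a ℚ.* c ℚ.≤ b ℚ.* d
  *-mono-≤ {a} {b} {c} {d} 0≤a 0≤d a≤b c≤d = ℚP.≤-trans
    (ℚP.*-monoˡ-≤-nonNeg a {{ℚ.nonNegative 0≤a}} c≤d)
    (ℚP.*-monoʳ-≤-nonNeg d {{ℚ.nonNegative 0≤d}} a≤b)

  p≤p+q : ∀ p {q} → 0ℚ ℚ.≤ q → p ℚ.≤ p ℚ.+ q
  p≤p+q p {q} 0≤q = subst (ℚ._≤ p ℚ.+ q) (ℚP.+-identityʳ p) (ℚP.+-monoʳ-≤ p 0≤q)

  0≤weight : ∀ n k → 0ℚ ℚ.≤ weight n k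
  0≤weight n k = ℚP.nonNegative⁻¹ (weight n k)
    {{ℚP.normalize-nonNeg 1 (suc n ℕ.^ k) {{ℕP.m^n≢0 (suc n) k}}}}

  1/-antimono : ∀ d e .{{_ : ℕ.NonZero d}} .{{_ : ℕ.NonZero e}} → d ℕ.≤ e → + 1 / e ℚ.≤ + 1 / d
  1/-antimono (suc d) (suc e) d≤e = ℚP.toℚᵘ-cancel-≤
    (ℚᵘP.≤-respˡ-≃ (ℚᵘP.≃-sym (ℚP.toℚᵘ-fromℚᵘ (ℚᵘ.mkℚᵘ (+ 1) e)))
      (ℚᵘP.≤-respʳ-≃ (ℚᵘP.≃-sym (ℚP.toℚᵘ-fromℚᵘ (ℚᵘ.mkℚᵘ (+ 1) d)))
        (ℚᵘ.*≤* (subst₂ ℤ._≤_ (sym (ℤP.*-identityˡ (+ suc d))) (sym (ℤP.*-identityˡ (+ suc e))) (ℤ.+≤+ d≤e)))))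

  weight-antimono : ∀ n {j k} → j ℕ.≤ k → weight n k ℚ.≤ weight n j
  weight-antimono n {j} {k} j≤k =
    1/-antimono (suc n ℕ.^ j) (suc n ℕ.^ k) {{ℕP.m^n≢0 (suc n) j}} {{ℕP.m^n≢0 (suc n) k}}
      (ℕP.^-monoʳ-≤ (suc n) j≤k)

  weight-1 : ∀ n → weight n 1 ≡ u n
  weight-1 n = ℚP./-cong {+ 1} {suc n ℕ.^ 1} {+ 1} {suc n} {{ℕP.m^n≢0 (suc n) 1}} refl (ℕP.*-identityʳ (suc n))

  weight-2 : ∀ n → weight n 2 ≡ u n ℚ.* u n
  weight-2 n = begin
    weight n 2                            ≡⟨ ℚP./-cong {+ 1} {suc n ℕ.^ 2} {+ 1} {suc n ℕ.* suc n} {{ℕP.m^n≢0 (suc n) 2}} refl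
                                               (cong (suc n ℕ.*_) (ℕP.*-identityʳ (suc n))) ⟩
    + 1 / (suc n ℕ.* suc n)               ≡⟨ ℚP.toℚᵘ-injective (ℚᵘP.≃-trans
         (ℚP.toℚᵘ-fromℚᵘ (ℚᵘ.mkℚᵘ (+ 1) (n ℕ.+ n ℕ.* suc n)))
         (ℚᵘP.≃-sym (ℚᵘP.≃-trans (ℚP.toℚᵘ-homo-* (u n) (u n))
           (ℚᵘP.≃-trans (ℚᵘP.*-cong (ℚP.toℚᵘ-fromℚᵘ (ℚᵘ.mkℚᵘ (+ 1) n)) (ℚP.toℚᵘ-fromℚᵘ (ℚᵘ.mkℚᵘ (+ 1) n)))
             (ℚᵘ.*≡* refl))))) ⟩
    u n ℚ.* u n                           ∎
    where open ≡-Reasoning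

  weight≤u : ∀ n {k} → 1 ℕ.≤ k → weight n k ℚ.≤ u n
  weight≤u n {k} 1≤k = subst (weight n k ℚ.≤_) (weight-1 n) (weight-antimono n {1} {k} 1≤k)

  weight≤u² : ∀ n {k} → 2 ℕ.≤ k → weight n k ℚ.≤ u n ℚ.* u n
  weight≤u² n {k} 2≤k = subst (weight n k ℚ.≤_) (weight-2 n) (weight-antimono n {2} {k} 2≤k)

  -- v n = 1 / (2n + 3)
  v : ℕ → ℚ
  v n = u (suc n ℕ.+ suc n)

  v-ι : ∀ n → v n ℚ.* (1ℚ ℚ.+ (ι (suc n) ℚ.+ ι (suc n))) ≡ 1ℚ
  v-ι n = trans (cong (v n ℚ.*_) (sym (trans (ι-suc (suc n ℕ.+ suc n)) (cong (1ℚ ℚ.+_) (ι-+ (suc n) (suc n))))))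
    (u-ι (suc n ℕ.+ suc n))

  q : ℕ → ℚ
  q zero    = 1ℚ
  q (suc n) = q n ℚ.* ((ι (suc n) ℚ.+ ι (suc n)) ℚ.* v n)

  0≤q : ∀ n → 0ℚ ℚ.≤ q n
  0≤q zero    = ℚP.nonNegative⁻¹ 1ℚ
  0≤q (suc n) = 0≤* (0≤q n) (0≤* (0≤+ (0≤ι (suc n)) (0≤ι (suc n))) (0≤u (suc n ℕ.+ suc n)))

  q-step : ∀ n → q n ≡ q (suc n) ℚ.+ q n ℚ.* v n
  q-step n = begin
    q n                                   ≡⟨ sym (ℚP.*-identityʳ (q n)) ⟩
    q n ℚ.* 1ℚ                            ≡⟨ cong (q n ℚ.*_) (sym (v-ι n)) ⟩
    q n ℚ.* (v n ℚ.* (1ℚ ℚ.+ (a ℚ.+ a)))  ≡⟨ solve 3 (λ q v a → q :* (v :* (con 1ℚ :+ (a :+ a))) := q :* ((a :+ a) :* v) :+ q :* v) refl (q n) (v n) a ⟩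
    q (suc n) ℚ.+ q n ℚ.* v n             ∎
    where
    open ≡-Reasoning
    a = ι (suc n)

  p : ℕ → ℚ
  p n = q n ℚ.* (1ℚ ℚ.+ (ι n ℚ.+ ι n))

  p-suc : ∀ n → p (suc n) ≡ q n ℚ.* (ι (suc n) ℚ.+ ι (suc n))
  p-suc n = begin
    q n ℚ.* ((a ℚ.+ a) ℚ.* v n) ℚ.* (1ℚ ℚ.+ (a ℚ.+ a))   ≡⟨ solve 3 (λ q b v → q :* (b :* v) :* (con 1ℚ :+ b) := q :* b :* (v :* (con 1ℚ :+ b))) refl (q n) (a ℚ.+ a) (v n) ⟩
    q n ℚ.* (a ℚ.+ a) ℚ.* (v n ℚ.* (1ℚ ℚ.+ (a ℚ.+ a)))   ≡⟨ cong (q n ℚ.* (a ℚ.+ a) ℚ.*_) (v-ι n) ⟩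
    q n ℚ.* (a ℚ.+ a) ℚ.* 1ℚ                             ≡⟨ ℚP.*-identityʳ _ ⟩
    q n ℚ.* (a ℚ.+ a)                                    ∎
    where
    open ≡-Reasoning
    a = ι (suc n)

  p-step : ∀ n → p (suc n) ≡ p n ℚ.+ q n
  p-step n = begin
    p (suc n)                                            ≡⟨ p-suc n ⟩
    q n ℚ.* (ι (suc n) ℚ.+ ι (suc n))                    ≡⟨ cong (λ z → q n ℚ.* (z ℚ.+ z)) (ι-suc n) ⟩
    q n ℚ.* ((1ℚ ℚ.+ ι n) ℚ.+ (1ℚ ℚ.+ ι n))              ≡⟨ solve 2 (λ q a → q :* ((con 1ℚ :+ a) :+ (con 1ℚ :+ a)) := q :* (con 1ℚ :+ (a :+ a)) :+ q) refl (q n) (ι n) ⟩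
    p n ℚ.+ q n                                          ∎
    where open ≡-Reasoning

  1≤p : ∀ n → 1ℚ ℚ.≤ p n
  1≤p zero    = ℚP.≤-refl
  1≤p (suc n) = ℚP.≤-trans (1≤p n) (subst (p n ℚ.≤_) (sym (p-step n)) (p≤p+q (p n) (0≤q n)))

  0≤p : ∀ n → 0ℚ ℚ.≤ p n
  0≤p n = ℚP.≤-trans (ℚP.nonNegative⁻¹ 1ℚ) (1≤p n)

  2^ : ℕ → ℚ
  2^ zero    = 1ℚ
  2^ (suc r) = 2^ r ℚ.+ 2^ r

  0≤2^ : ∀ r → 0ℚ ℚ.≤ 2^ r
  0≤2^ zero    = ℚP.nonNegative⁻¹ 1ℚ
  0≤2^ (suc r) = 0≤+ (0≤2^ r) (0≤2^ r)

  0≤partialSum : ∀ {r} l (k : Vec ℕ r) N → 0ℚ ℚ.≤ partialSum l k N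
  0≤partialSum l []       N       = ℚP.nonNegative⁻¹ 1ℚ
  0≤partialSum l (k ∷ ks) zero    = ℚP.≤-refl
  0≤partialSum l (k ∷ ks) (suc N) = 0≤+ (0≤partialSum l (k ∷ ks) N)
    (0≤* (0≤weight (l ℕ.+ N) k) (0≤partialSum l ks (suc N)))

  u*p : ∀ n c → u n ℚ.* (c ℚ.* p (suc n)) ≡ (c ℚ.+ c) ℚ.* q n
  u*p n c = begin
    u n ℚ.* (c ℚ.* p (suc n))             ≡⟨ cong (λ z → u n ℚ.* (c ℚ.* z)) (p-suc n) ⟩
    u n ℚ.* (c ℚ.* (q n ℚ.* (a ℚ.+ a)))   ≡⟨ solve 4 (λ u c q a → u :* (c :* (q :* (a :+ a))) := (c :+ c) :* q :* (u :* a)) refl (u n) c (q n) a ⟩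
    (c ℚ.+ c) ℚ.* q n ℚ.* (u n ℚ.* a)     ≡⟨ cong ((c ℚ.+ c) ℚ.* q n ℚ.*_) (u-ι n) ⟩
    (c ℚ.+ c) ℚ.* q n ℚ.* 1ℚ              ≡⟨ ℚP.*-identityʳ _ ⟩
    (c ℚ.+ c) ℚ.* q n                     ∎
    where
    open ≡-Reasoning
    a = ι (suc n)

  partialSum≤p : ∀ {r} l (k : Vec ℕ r) → All (1 ℕ.≤_) k → ∀ N → partialSum l k N ℚ.≤ 2^ r ℚ.* p (l ℕ.+ N)
  partialSum≤p l []       []          N    = subst (1ℚ ℚ.≤_) (sym (ℚP.*-identityˡ _)) (1≤p (l ℕ.+ N))
  partialSum≤p {suc r} l (k ∷ ks) (_ ∷ _) zero = 0≤* (0≤2^ (suc r)) (0≤p (l ℕ.+ 0))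
  partialSum≤p {suc r} l (k ∷ ks) (1≤k ∷ 1≤ks) (suc N) = begin
    partialSum l (k ∷ ks) N ℚ.+ weight n k ℚ.* partialSum l ks (suc N)
      ≤⟨ ℚP.+-mono-≤ (partialSum≤p l (k ∷ ks) (1≤k ∷ 1≤ks) N)
           (*-mono-≤ (0≤weight n k) (0≤* (0≤2^ r) (0≤p (suc n))) (weight≤u n {k} 1≤k)
             (subst (λ z → partialSum l ks (suc N) ℚ.≤ 2^ r ℚ.* p z) (ℕP.+-suc l N) (partialSum≤p l ks 1≤ks (suc N)))) ⟩
    2^ (suc r) ℚ.* p n ℚ.+ u n ℚ.* (2^ r ℚ.* p (suc n))
      ≡⟨ cong (2^ (suc r) ℚ.* p n ℚ.+_) (u*p n (2^ r)) ⟩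
    2^ (suc r) ℚ.* p n ℚ.+ 2^ (suc r) ℚ.* q n
      ≡⟨ sym (ℚP.*-distribˡ-+ (2^ (suc r)) (p n) (q n)) ⟩
    2^ (suc r) ℚ.* (p n ℚ.+ q n)
      ≡⟨ cong (2^ (suc r) ℚ.*_) (sym (trans (cong p (ℕP.+-suc l N)) (p-step n))) ⟩
    2^ (suc r) ℚ.* p (l ℕ.+ suc N) ∎
    where
    open ℚP.≤-Reasoning
    n = l ℕ.+ N

  u≤3v : ∀ n → u n ℚ.≤ v n ℚ.+ v n ℚ.+ v n
  u≤3v n = begin
    u n                                              ≤⟨ p≤p+q (u n) (0≤* (0≤* (0≤u n) (0≤ι n)) (0≤u (suc n ℕ.+ suc n))) ⟩
    u n ℚ.+ u n ℚ.* ι n ℚ.* v n                      ≡⟨ cong (ℚ._+ u n ℚ.* ι n ℚ.* v n) (sym (trans (cong (u n ℚ.*_) (v-ι n)) (ℚP.*-identityʳ (u n)))) ⟩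
    u n ℚ.* (v n ℚ.* (1ℚ ℚ.+ (ι (suc n) ℚ.+ ι (suc n)))) ℚ.+ u n ℚ.* ι n ℚ.* v n
      ≡⟨ cong (λ z → u n ℚ.* (v n ℚ.* (1ℚ ℚ.+ (z ℚ.+ z))) ℚ.+ u n ℚ.* ι n ℚ.* v n) (ι-suc n) ⟩
    u n ℚ.* (v n ℚ.* (1ℚ ℚ.+ ((1ℚ ℚ.+ ι n) ℚ.+ (1ℚ ℚ.+ ι n)))) ℚ.+ u n ℚ.* ι n ℚ.* v n
      ≡⟨ solve 3 (λ u v a → u :* (v :* (con 1ℚ :+ ((con 1ℚ :+ a) :+ (con 1ℚ :+ a)))) :+ u :* a :* v
                         := (u :* (con 1ℚ :+ a)) :* (v :+ v :+ v)) refl (u n) (v n) (ι n) ⟩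
    (u n ℚ.* (1ℚ ℚ.+ ι n)) ℚ.* (v n ℚ.+ v n ℚ.+ v n) ≡⟨ cong (ℚ._* (v n ℚ.+ v n ℚ.+ v n)) (trans (cong (u n ℚ.*_) (sym (ι-suc n))) (u-ι n)) ⟩
    1ℚ ℚ.* (v n ℚ.+ v n ℚ.+ v n)                     ≡⟨ ℚP.*-identityˡ _ ⟩
    v n ℚ.+ v n ℚ.+ v n                              ∎
    where open ℚP.≤-Reasoning

  q²ι≤1 : ∀ n → q n ℚ.* q n ℚ.* ι (suc n) ℚ.≤ 1ℚ
  q²ι≤1 zero    = ℚP.≤-refl
  q²ι≤1 (suc n) = begin
    q (suc n) ℚ.* q (suc n) ℚ.* ι (suc (suc n))   ≡⟨ cong (q (suc n) ℚ.* q (suc n) ℚ.*_) (ι-suc (suc n)) ⟩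
    q (suc n) ℚ.* q (suc n) ℚ.* (1ℚ ℚ.+ a)        ≤⟨ p≤p+q _ (0≤* 0≤x (0≤* (0≤u (suc n ℕ.+ suc n)) (0≤u (suc n ℕ.+ suc n)))) ⟩
    q (suc n) ℚ.* q (suc n) ℚ.* (1ℚ ℚ.+ a) ℚ.+ x ℚ.* (v n ℚ.* v n)
      ≡⟨ solve 3 (λ q v a → q :* ((a :+ a) :* v) :* (q :* ((a :+ a) :* v)) :* (con 1ℚ :+ a) :+ q :* q :* a :* (v :* v)
                := q :* q :* a :* ((v :* (con 1ℚ :+ (a :+ a))) :* (v :* (con 1ℚ :+ (a :+ a))))) refl (q n) (v n) a ⟩
    x ℚ.* ((v n ℚ.* (1ℚ ℚ.+ (a ℚ.+ a))) ℚ.* (v n ℚ.* (1ℚ ℚ.+ (a ℚ.+ a))))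
      ≡⟨ cong (λ z → x ℚ.* (z ℚ.* z)) (v-ι n) ⟩
    x ℚ.* (1ℚ ℚ.* 1ℚ)                             ≡⟨ ℚP.*-identityʳ x ⟩
    x                                             ≤⟨ q²ι≤1 n ⟩
    1ℚ                                            ∎
    where
    open ℚP.≤-Reasoning
    a = ι (suc n)
    x = q n ℚ.* q n ℚ.* a
    0≤x : 0ℚ ℚ.≤ x
    0≤x = 0≤* (0≤* (0≤q n) (0≤q n)) (0≤ι (suc n))

  archimedean : ∀ x → ∃[ M ] ∀ n → M ℕ.≤ n → x ℚ.< ι (suc n)
  archimedean x@record{} = ℤ.∣ ℚ.↥ x ∣ , λ n M≤n → ℚP.toℚᵘ-cancel-<
    (ℚᵘP.<-respʳ-≃ (ℚᵘP.≃-sym (ℚP.toℚᵘ-fromℚᵘ (ℚᵘ.mkℚᵘ (+ suc n) 0))) (ℚᵘ.*<* (num n M≤n)))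
    where
    num : ∀ n → ℤ.∣ ℚ.↥ x ∣ ℕ.≤ n → ℚ.↥ x ℤ.* + 1 ℤ.< + suc n ℤ.* ℚ.↧ x
    num n M≤n = begin-strict
      ℚ.↥ x ℤ.* + 1       ≡⟨ ℤP.*-identityʳ (ℚ.↥ x) ⟩
      ℚ.↥ x               ≤⟨ i≤∣i∣ (ℚ.↥ x) ⟩
      + ℤ.∣ ℚ.↥ x ∣       <⟨ ℤ.+<+ (s≤s M≤n) ⟩
      + suc n             ≤⟨ ℤ.+≤+ (ℕP.m≤m*n (suc n) (ℚ.↧ₙ x)) ⟩
      + (suc n ℕ.* ℚ.↧ₙ x) ≡⟨ ℤP.pos-* (suc n) (ℚ.↧ₙ x) ⟩
      + suc n ℤ.* ℚ.↧ x   ∎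
      where
      open ℤP.≤-Reasoning
      i≤∣i∣ : ∀ i → i ℤ.≤ + ℤ.∣ i ∣
      i≤∣i∣ (+ n)    = ℤP.≤-refl
      i≤∣i∣ -[1+ n ] = ℤ.-≤+

  q→0 : ∀ c → 0ℚ ℚ.≤ c → ∀ ε → 0ℚ ℚ.< ε → ∃[ M ] ∀ n → M ℕ.≤ n → c ℚ.* q n ℚ.< ε
  q→0 c 0≤c ε ε>0 with archimedean ((c ℚ.* 1/ε) ℚ.* (c ℚ.* 1/ε))
    where 1/ε = (ℚ.1/ ε) {{ℚP.pos⇒nonZero ε {{ℚ.positive ε>0}}}}
  ... | M , h = M , λ n M≤n → ℚP.≰⇒> λ ε≤cq → ℚP.<-irrefl refl (bad n (h n M≤n) ε≤cq)
    where
    open ℚP.≤-Reasoning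
    instance
      _ = ℚP.pos⇒nonZero ε {{ℚ.positive ε>0}}
    t = c ℚ.* ℚ.1/ ε
    0≤1/ε : 0ℚ ℚ.≤ ℚ.1/ ε
    0≤1/ε = ℚP.<⇒≤ (ℚP.positive⁻¹ (ℚ.1/ ε) {{ℚP.1/pos⇒pos ε {{ℚ.positive ε>0}}}})
    1≤tq : ∀ n → ε ℚ.≤ c ℚ.* q n → 1ℚ ℚ.≤ t ℚ.* q n
    1≤tq n ε≤cq = subst₂ ℚ._≤_ (ℚP.*-inverseˡ ε)
      (solve 3 (λ e c q → e :* (c :* q) := c :* e :* q) refl (ℚ.1/ ε) c (q n))
      (ℚP.*-monoˡ-≤-nonNeg (ℚ.1/ ε) {{ℚ.nonNegative 0≤1/ε}} ε≤cq)
    bad : ∀ n → t ℚ.* t ℚ.< ι (suc n) → ε ℚ.≤ c ℚ.* q n → ι (suc n) ℚ.< ι (suc n)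
    bad n t²<ι ε≤cq = begin-strict
      ι (suc n)                                        ≡⟨ sym (ℚP.*-identityʳ (ι (suc n))) ⟩
      ι (suc n) ℚ.* (1ℚ ℚ.* 1ℚ)                        ≤⟨ ℚP.*-monoˡ-≤-nonNeg (ι (suc n)) {{ℚ.nonNegative (0≤ι (suc n))}}
                                                            (*-mono-≤ (ℚP.nonNegative⁻¹ 1ℚ) (ℚP.≤-trans (ℚP.nonNegative⁻¹ 1ℚ) (1≤tq n ε≤cq))
                                                              (1≤tq n ε≤cq) (1≤tq n ε≤cq)) ⟩
      ι (suc n) ℚ.* ((t ℚ.* q n) ℚ.* (t ℚ.* q n))      ≡⟨ solve 3 (λ a t q → a :* ((t :* q) :* (t :* q)) := t :* t :* (q :* q :* a)) refl (ι (suc n)) t (q n) ⟩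
      t ℚ.* t ℚ.* (q n ℚ.* q n ℚ.* ι (suc n))          ≤⟨ ℚP.*-monoˡ-≤-nonNeg (t ℚ.* t) {{ℚ.nonNegative (0≤* (0≤* 0≤c 0≤1/ε) (0≤* 0≤c 0≤1/ε))}} (q²ι≤1 n) ⟩
      t ℚ.* t ℚ.* 1ℚ                                   ≡⟨ ℚP.*-identityʳ (t ℚ.* t) ⟩
      t ℚ.* t                                          <⟨ t²<ι ⟩
      ι (suc n)                                        ∎

  increasing⇒≤ : (f : ℕ → ℚ) → (∀ n → f n ℚ.≤ f (suc n)) → ∀ {m n} → m ℕ.≤ n → f m ℚ.≤ f n
  increasing⇒≤ f f↑ m≤n = go (ℕP.≤⇒≤′ m≤n)
    where
    go : ∀ {m n} → m ℕ.≤′ n → f m ℚ.≤ f n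
    go ℕ.≤′-refl       = ℚP.≤-refl
    go (ℕ.≤′-step m≤n) = ℚP.≤-trans (go m≤n) (f↑ _)

  decreasing⇒≥ : (f : ℕ → ℚ) → (∀ n → f (suc n) ℚ.≤ f n) → ∀ {m n} → m ℕ.≤ n → f n ℚ.≤ f m
  decreasing⇒≥ f f↓ m≤n = go (ℕP.≤⇒≤′ m≤n)
    where
    go : ∀ {m n} → m ℕ.≤′ n → f n ℚ.≤ f m
    go ℕ.≤′-refl       = ℚP.≤-refl
    go (ℕ.≤′-step m≤n) = ℚP.≤-trans (f↓ _) (go m≤n)

  squeeze⇒cauchy : (f g : ℕ → ℚ) → (∀ n → f n ℚ.≤ f (suc n)) →
    (∀ n → f (suc n) ℚ.+ g (suc n) ℚ.≤ f n ℚ.+ g n) → (∀ n → 0ℚ ℚ.≤ g n) →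
    (∀ ε → 0ℚ ℚ.< ε → ∃[ M ] ∀ n → M ℕ.≤ n → g n ℚ.< ε) → IsCauchy f
  squeeze⇒cauchy f g f↑ f+g↓ 0≤g g→0 ε ε>0 with g→0 ε ε>0
  ... | M , g<ε = M , close
    where
    open ℚP.≤-Reasoning
    upper : ∀ m n → m ℕ.≤ n → f n ℚ.- f m ℚ.≤ g m
    upper m n m≤n = begin
      f n ℚ.- f m               ≤⟨ ℚP.+-monoˡ-≤ (ℚ.- f m) (p≤p+q (f n) (0≤g n)) ⟩
      (f n ℚ.+ g n) ℚ.- f m     ≤⟨ ℚP.+-monoˡ-≤ (ℚ.- f m) (decreasing⇒≥ (λ i → f i ℚ.+ g i) f+g↓ m≤n) ⟩
      (f m ℚ.+ g m) ℚ.- f m     ≡⟨ solve 2 (λ a b → (a :+ b) :- a := b) refl (f m) (g m) ⟩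
      g m                       ∎
    ordered : ∀ m n → M ℕ.≤ m → m ℕ.≤ n → ℚ.∣ f n ℚ.- f m ∣ ℚ.< ε
    ordered m n M≤m m≤n = begin-strict
      ℚ.∣ f n ℚ.- f m ∣   ≡⟨ ℚP.0≤p⇒∣p∣≡p (subst (ℚ._≤ f n ℚ.- f m) (ℚP.+-inverseʳ (f m))
                               (ℚP.+-monoˡ-≤ (ℚ.- f m) (increasing⇒≤ f f↑ m≤n))) ⟩
      f n ℚ.- f m         ≤⟨ upper m n m≤n ⟩
      g m                 <⟨ g<ε m M≤m ⟩
      ε                   ∎
    close : ∀ m n → M ℕ.≤ m → M ℕ.≤ n → ℚ.∣ f m ℚ.- f n ∣ ℚ.< ε
    close m n M≤m M≤n with ℕP.≤-total m n
    ... | inj₁ m≤n = subst (ℚ._< ε) (∣p-q∣≡∣q-p∣ (f n) (f m)) (ordered m n M≤m m≤n)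
    ... | inj₂ n≤m = ordered n m M≤n n≤m

  partialSum-cauchy : ∀ {r} l {k : Vec ℕ r} → Admissible k → IsCauchy (partialSum l k)
  partialSum-cauchy {suc r} l {k ∷ ks} (2≤k ∷ 1≤ks) =
    squeeze⇒cauchy (partialSum l (k ∷ ks)) (λ N → C ℚ.* q (l ℕ.+ N))
      (λ N → p≤p+q _ (0≤* (0≤weight (l ℕ.+ N) k) (0≤partialSum l ks (suc N))))
      step
      (λ N → 0≤* 0≤C (0≤q (l ℕ.+ N)))
      λ ε ε>0 → let M , h = q→0 C 0≤C ε ε>0 in
        M , λ n M≤n → h (l ℕ.+ n) (ℕP.≤-trans M≤n (ℕP.m≤n+m n l))
    where
    open ℚP.≤-Reasoning
    D C : ℚ
    D = 2^ (suc r)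
    C = D ℚ.+ D ℚ.+ D
    0≤C : 0ℚ ℚ.≤ C
    0≤C = 0≤+ (0≤+ (0≤2^ (suc r)) (0≤2^ (suc r))) (0≤2^ (suc r))
    increment : ∀ N → weight (l ℕ.+ N) k ℚ.* partialSum l ks (suc N) ℚ.≤ C ℚ.* (q (l ℕ.+ N) ℚ.* v (l ℕ.+ N))
    increment N = begin
      weight n k ℚ.* partialSum l ks (suc N)
        ≤⟨ *-mono-≤ (0≤weight n k) (0≤* (0≤2^ r) (0≤p (suc n))) (weight≤u² n {k} 2≤k)
             (subst (λ z → partialSum l ks (suc N) ℚ.≤ 2^ r ℚ.* p z) (ℕP.+-suc l N) (partialSum≤p l ks 1≤ks (suc N))) ⟩
      u n ℚ.* u n ℚ.* (2^ r ℚ.* p (suc n))        ≡⟨ ℚP.*-assoc (u n) (u n) _ ⟩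
      u n ℚ.* (u n ℚ.* (2^ r ℚ.* p (suc n)))      ≡⟨ cong (u n ℚ.*_) (u*p n (2^ r)) ⟩
      u n ℚ.* (D ℚ.* q n)                         ≤⟨ ℚP.*-monoʳ-≤-nonNeg (D ℚ.* q n) {{ℚ.nonNegative (0≤* (0≤2^ (suc r)) (0≤q n))}} (u≤3v n) ⟩
      (v n ℚ.+ v n ℚ.+ v n) ℚ.* (D ℚ.* q n)       ≡⟨ solve 3 (λ v d q → (v :+ v :+ v) :* (d :* q) := (d :+ d :+ d) :* (q :* v)) refl (v n) D (q n) ⟩
      C ℚ.* (q n ℚ.* v n)                         ∎
      where n = l ℕ.+ N
    step : ∀ N → partialSum l (k ∷ ks) (suc N) ℚ.+ C ℚ.* q (l ℕ.+ suc N) ℚ.≤ partialSum l (k ∷ ks) N ℚ.+ C ℚ.* q (l ℕ.+ N)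
    step N = begin
      (S ℚ.+ w) ℚ.+ C ℚ.* q (l ℕ.+ suc N)         ≡⟨ cong (λ z → (S ℚ.+ w) ℚ.+ C ℚ.* q z) (ℕP.+-suc l N) ⟩
      (S ℚ.+ w) ℚ.+ C ℚ.* q (suc n)               ≤⟨ ℚP.+-monoˡ-≤ (C ℚ.* q (suc n)) (ℚP.+-monoʳ-≤ S (increment N)) ⟩
      (S ℚ.+ C ℚ.* (q n ℚ.* v n)) ℚ.+ C ℚ.* q (suc n)
        ≡⟨ solve 4 (λ s c a b → (s :+ c :* a) :+ c :* b := s :+ c :* (b :+ a)) refl S C (q n ℚ.* v n) (q (suc n)) ⟩
      S ℚ.+ C ℚ.* (q (suc n) ℚ.+ q n ℚ.* v n)     ≡⟨ cong (λ z → S ℚ.+ C ℚ.* z) (sym (q-step n)) ⟩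
      S ℚ.+ C ℚ.* q n                             ∎
      where
      n = l ℕ.+ N
      S = partialSum l (k ∷ ks) N
      w = weight n k ℚ.* partialSum l ks (suc N)

------------------------------------------------------------------------
-- Multiple zeta-star values

-- The sum of 1 / (n₁ ^ k₁ ⋯ nᵣ ^ kᵣ) over n₁ ≥ ⋯ ≥ nᵣ > l.
starSeries : ∀ {r} → ℕ → (k : Vec ℕ r) → Admissible k → ℝ
starSeries l k adm = mkℝ (partialSum l k) (Convergence.partialSum-cauchy l adm)

ζ⋆ : ∀ {r} (k : Vec ℕ r) → Admissible k → ℝ
ζ⋆ = starSeries 0

𝒵⋆ : Pred ℝ 0ℓ
𝒵⋆ x = ∃[ r ] Σ[ k ∈ Vec ℕ r ] Σ[ adm ∈ Admissible k ] x ≃ ζ⋆ k adm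

All-∷ʳ1 : ∀ {r} {k : Vec ℕ r} → All (1 ℕ.≤_) k → All (1 ℕ.≤_) (k ∷ʳ 1)
All-∷ʳ1 []       = s≤s z≤n ∷ []
All-∷ʳ1 (h ∷ hs) = h ∷ All-∷ʳ1 hs

Admissible-∷ʳ1 : ∀ {r} {k : Vec ℕ r} → Admissible k → Admissible (k ∷ʳ 1)
Admissible-∷ʳ1 (h ∷ hs) = h ∷ All-∷ʳ1 hs

-- The sum of 1 / (n₁ ^ k₁ ⋯ nᵣ ^ kᵣ nᵣ₊₁) over n₁ ≥ ⋯ ≥ nᵣ ≥ nᵣ₊₁ ≥ 2.
gap : ∀ {r} (k : Vec ℕ r) → Admissible k → ℝ
gap k adm = starSeries 1 (k ∷ʳ 1) (Admissible-∷ʳ1 adm)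

{-# OPTIONS --safe #-}

-- Write g_t for the increment of the truncated sums when the t-th exponent is
-- appended.  The tail over n₁ ≥ ⋯ ≥ n_t ≥ m, multiplied by m, decreases in m, which
-- gives g_{t+1} ≤ (3/2) g_t and hence gap(k₁, …, k_r) = g_{r+1} ≤ g_r + g_{r-1}.
-- Comparing exponent vectors lexicographically, a value of depth s ≤ r - 2 is
-- therefore at distance at least the gap from ζ⋆(k₁, …, k_r): it is at most
-- ζ⋆(k₁, …, k_{r-2}) or at least ζ⋆(k₁, …, k_r, 1).
--
-- Conversely, every α > 1 has an expansion α = ζ⋆(k₁, k₂, …), where ζ⋆(k₁, …, k_r)
-- is within its gap of α as soon as k_{r+1} ≥ 2.  If this happens only finitely
-- often, the expansion ends in 1, 1, 1, … after some last k_s ≥ 2, and since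
-- ∑_{n ≥ n_1 ≥ ⋯ ≥ n_j ≥ 1} 1 / (n_1 ⋯ n_j) tends to n as j → ∞,
-- ζ⋆(k₁, …, k_s, 1, 1, …) equals ζ⋆(k₁, …, k_s - 1), so α ∈ 𝒵⋆.

module Submission where

open import Defs
open import Data.Empty using (⊥)
open import Data.Integer.Base using (+_)
open import Data.Nat.Base as ℕ using (ℕ; zero; suc; z≤n; s≤s)
open import Data.Nat.InfinitelyOften using (Fin; Inf)
import Data.Nat.Properties as ℕP
open import Data.Product.Base using (Σ-syntax; ∃-syntax; _×_; _,_; proj₁; proj₂)
open import Data.Rational.Base as ℚ using (ℚ; 0ℚ; 1ℚ; ½; _/_)
import Data.Rational.Properties as ℚP
open import Data.Rational.Solver using (module +-*-Solver)
import Data.Rational.Unnormalised.Base as ℚᵘ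
import Data.Rational.Unnormalised.Properties as ℚᵘP
open import Data.Sum.Base using (_⊎_; inj₁; inj₂)
open import Data.Vec.Base using (Vec; []; _∷_; _∷ʳ_; _++_; replicate; initLast)
open import Data.Vec.Relation.Unary.All using (All; []; _∷_)
open import Function.Bundles using (_⇔_; mk⇔)
open import Relation.Binary.Definitions using (tri<; tri≈; tri>)
open import Relation.Binary.PropositionalEquality
open import Relation.Nullary.Decidable.Core using (yes; no; from-yes)
open import Relation.Nullary.Negation.Core using (¬_; contradiction)
open import Relation.Unary using (_∉_)
open +-*-Solver using (solve; _:+_; _:*_; _:-_; :-_; con; _:=_)
open Convergence using (ι; u; ι-suc; ι-+; 0≤ι; u-ι; 0≤u; 0≤*; 0≤+; *-mono-≤; p≤p+q; 0≤weight;
  1/-antimono; weight-1; weight-antimono; weight≤u; weight≤u²; archimedean; increasing⇒≤;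
  0≤partialSum)

-- Rational inequalities, finite sums and weights.

0≤q-p : ∀ {p q} → p ℚ.≤ q → 0ℚ ℚ.≤ q ℚ.- p
0≤q-p {p} {q} p≤q = subst (ℚ._≤ q ℚ.- p) (ℚP.+-inverseʳ p) (ℚP.+-monoˡ-≤ (ℚ.- p) p≤q)

-- Linear arithmetic: q - p is exhibited as a sum of differences known to be nonnegative.
≤-by : ∀ {p q s} → q ℚ.- p ≡ s → 0ℚ ℚ.≤ s → p ℚ.≤ q
≤-by {p} {q} eq 0≤s = subst₂ ℚ._≤_ (ℚP.+-identityˡ p)
  (solve 2 (λ p q → (q :- p) :+ p := q) refl p q)
  (ℚP.+-monoˡ-≤ p (subst (0ℚ ℚ.≤_) (sym eq) 0≤s))

*-monoˡ : ∀ {c p q} → 0ℚ ℚ.≤ c → p ℚ.≤ q → c ℚ.* p ℚ.≤ c ℚ.* q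
*-monoˡ {c} 0≤c = ℚP.*-monoˡ-≤-nonNeg c {{ℚ.nonNegative 0≤c}}

∑-cong : ∀ {f g : ℕ → ℚ} → (∀ i → f i ≡ g i) → ∀ N → ∑ N f ≡ ∑ N g
∑-cong f≡g zero    = refl
∑-cong f≡g (suc N) = cong₂ ℚ._+_ (∑-cong f≡g N) (f≡g N)

∑-mono : ∀ {f g : ℕ → ℚ} → (∀ i → f i ℚ.≤ g i) → ∀ N → ∑ N f ℚ.≤ ∑ N g
∑-mono f≤g zero    = ℚP.≤-refl
∑-mono f≤g (suc N) = ℚP.+-mono-≤ (∑-mono f≤g N) (f≤g N)

∑-head : ∀ (f : ℕ → ℚ) N → ∑ (suc N) f ≡ f 0 ℚ.+ ∑ N (λ i → f (suc i))
∑-head f zero    = trans (ℚP.+-identityˡ (f 0)) (sym (ℚP.+-identityʳ (f 0)))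
∑-head f (suc N) = trans (cong (ℚ._+ f (suc N)) (∑-head f N)) (ℚP.+-assoc (f 0) _ (f (suc N)))

∑-linear : ∀ (f g : ℕ → ℚ) c N → ∑ N (λ i → f i ℚ.+ c ℚ.* g i) ≡ ∑ N f ℚ.+ c ℚ.* ∑ N g
∑-linear f g c zero    = sym (trans (ℚP.+-identityˡ (c ℚ.* 0ℚ)) (ℚP.*-zeroʳ c))
∑-linear f g c (suc N) = trans (cong (ℚ._+ (f N ℚ.+ c ℚ.* g N)) (∑-linear f g c N))
  (solve 5 (λ a b c d e → (a :+ c :* b) :+ (d :+ c :* e) := (a :+ d) :+ c :* (b :+ e)) refl
    (∑ N f) (∑ N g) c (f N) (g N))

weight-suc : ∀ n k → weight n (suc k) ≡ u n ℚ.* weight n k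
weight-suc n k = recip-* n (suc n ℕ.^ k) {{ℕP.m^n≢0 (suc n) k}} {{ℕP.m^n≢0 (suc n) (suc k)}}
  where
  recip-* : ∀ d e .{{_ : ℕ.NonZero e}} .{{_ : ℕ.NonZero (suc d ℕ.* e)}} →
    + 1 / (suc d ℕ.* e) ≡ u d ℚ.* (+ 1 / e)
  recip-* d (suc e) = ℚP.toℚᵘ-injective (ℚᵘP.≃-trans
    (ℚP.toℚᵘ-fromℚᵘ (ℚᵘ.mkℚᵘ (+ 1) (e ℕ.+ d ℕ.* suc e)))
    (ℚᵘP.≃-sym (ℚᵘP.≃-trans (ℚP.toℚᵘ-homo-* (+ 1 / suc d) (+ 1 / suc e))
      (ℚᵘP.≃-trans (ℚᵘP.*-cong (ℚP.toℚᵘ-fromℚᵘ (ℚᵘ.mkℚᵘ (+ 1) d)) (ℚP.toℚᵘ-fromℚᵘ (ℚᵘ.mkℚᵘ (+ 1) e)))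
        (ℚᵘ.*≡* refl)))))

weight-base-1 : ∀ k → weight 0 k ≡ 1ℚ
weight-base-1 zero    = refl
weight-base-1 (suc k) = trans (weight-suc 0 k) (cong (u 0 ℚ.*_) (weight-base-1 k))

weight-base-antimono : ∀ {m n} k → m ℕ.≤ n → weight n k ℚ.≤ weight m k
weight-base-antimono {m} {n} k m≤n =
  1/-antimono (suc m ℕ.^ k) (suc n ℕ.^ k) {{ℕP.m^n≢0 (suc m) k}} {{ℕP.m^n≢0 (suc n) k}}
    (ℕP.^-monoˡ-≤ k (s≤s m≤n))

-- Splits one term off a telescoping sum; `tail-≤u` iterates it.
u-suc : ∀ n → u n ≡ u (suc n) ℚ.+ u (suc n) ℚ.* u n
u-suc n = begin
  u n                                      ≡⟨ sym (ℚP.*-identityʳ (u n)) ⟩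
  u n ℚ.* 1ℚ                               ≡⟨ cong (u n ℚ.*_) (sym (trans (cong (u (suc n) ℚ.*_) (sym (ι-suc (suc n)))) (u-ι (suc n)))) ⟩
  u n ℚ.* (u (suc n) ℚ.* (1ℚ ℚ.+ a))       ≡⟨ solve 3 (λ x y a → x :* (y :* (con 1ℚ :+ a)) := (x :* a) :* y :+ y :* x) refl (u n) (u (suc n)) a ⟩
  (u n ℚ.* a) ℚ.* u (suc n) ℚ.+ u (suc n) ℚ.* u n
    ≡⟨ cong (λ z → z ℚ.* u (suc n) ℚ.+ u (suc n) ℚ.* u n) (u-ι n) ⟩
  1ℚ ℚ.* u (suc n) ℚ.+ u (suc n) ℚ.* u n   ≡⟨ cong (ℚ._+ u (suc n) ℚ.* u n) (ℚP.*-identityˡ (u (suc n))) ⟩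
  u (suc n) ℚ.+ u (suc n) ℚ.* u n          ∎
  where
  open ≡-Reasoning
  a = ι (suc n)

u-antimono : ∀ n → u (suc n) ℚ.≤ u n
u-antimono n = 1/-antimono (suc n) (suc (suc n)) (ℕP.n≤1+n (suc n))

-- Nested sums with a function of the innermost variable.

-- nested f (k₁ ∷ … ∷ kᵣ) N is the sum of f nᵣ / (n₁ ^ k₁ ⋯ nᵣ ^ kᵣ) over
-- N ≥ n₁ ≥ ⋯ ≥ nᵣ ≥ 1.
nested : ∀ {r} → (ℕ → ℚ) → Vec ℕ r → ℕ → ℚ
nested f []       N = f N
nested f (k ∷ ks) N = ∑ N λ i → weight i k ℚ.* nested f ks (suc i)

partialSum≡nested : ∀ {r} (ks : Vec ℕ r) N → partialSum 0 ks N ≡ nested (λ _ → 1ℚ) ks N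
partialSum≡nested []       N = refl
partialSum≡nested (k ∷ ks) N = ∑-cong (λ i → cong (weight i k ℚ.*_) (partialSum≡nested ks (suc i))) N

nested-∷ʳ : ∀ {r} f (ks : Vec ℕ r) k N → nested f (ks ∷ʳ k) N ≡ nested (nested f (k ∷ [])) ks N
nested-∷ʳ f []       k N = refl
nested-∷ʳ f (x ∷ ks) k N = ∑-cong (λ i → cong (weight i x ℚ.*_) (nested-∷ʳ f ks k (suc i))) N

nested-cong : ∀ {r} {f g} → (∀ n → f n ≡ g n) → ∀ (ks : Vec ℕ r) N → nested f ks N ≡ nested g ks N
nested-cong f≡g []       N = f≡g N
nested-cong f≡g (k ∷ ks) N = ∑-cong (λ i → cong (weight i k ℚ.*_) (nested-cong f≡g ks (suc i))) N

nested-mono : ∀ {r} {f g} → (∀ n → f (suc n) ℚ.≤ g (suc n)) →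
  ∀ (ks : Vec ℕ r) n → nested f ks (suc n) ℚ.≤ nested g ks (suc n)
nested-mono f≤g []       n = f≤g n
nested-mono f≤g (k ∷ ks) n = ∑-mono (λ i → *-monoˡ (0≤weight i k) (nested-mono f≤g ks i)) (suc n)

nested-linear : ∀ {r} f g c (ks : Vec ℕ r) N →
  nested (λ n → f n ℚ.+ c ℚ.* g n) ks N ≡ nested f ks N ℚ.+ c ℚ.* nested g ks N
nested-linear f g c []       N = refl
nested-linear f g c (k ∷ ks) N = trans
  (∑-cong (λ i → trans (cong (weight i k ℚ.*_) (nested-linear f g c ks (suc i)))
     (solve 4 (λ w x c y → w :* (x :+ c :* y) := w :* x :+ c :* (w :* y)) refl
       (weight i k) (nested f ks (suc i)) c (nested g ks (suc i)))) N)
  (∑-linear (λ i → weight i k ℚ.* nested f ks (suc i)) (λ i → weight i k ℚ.* nested g ks (suc i)) c N)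

-- A weight with exponent at least 1 times a value of at most `ι (suc i)` is at most 1, so each of
-- the N outer terms is at most 1.
nested-≤ι : ∀ {r f} → (∀ n → f (suc n) ℚ.≤ ι (suc n)) → {ks : Vec ℕ r} → All (1 ℕ.≤_) ks →
  ∀ n → nested f ks (suc n) ℚ.≤ ι (suc n)
nested-≤ι f≤ι []                         n = f≤ι n
nested-≤ι {f = f} f≤ι {k ∷ ks} (1≤k ∷ 1≤ks) n = bound (suc n)
  where
  bound : ∀ N → nested f (k ∷ ks) N ℚ.≤ ι N
  bound zero    = ℚP.≤-refl
  bound (suc N) = begin
    nested f (k ∷ ks) N ℚ.+ weight N k ℚ.* nested f ks (suc N)
      ≤⟨ ℚP.+-mono-≤ (bound N) (*-mono-≤ (0≤weight N k) (0≤ι (suc N)) (weight≤u N {k} 1≤k) (nested-≤ι f≤ι 1≤ks N)) ⟩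
    ι N ℚ.+ u N ℚ.* ι (suc N)   ≡⟨ cong (ι N ℚ.+_) (u-ι N) ⟩
    ι N ℚ.+ 1ℚ                  ≡⟨ trans (ℚP.+-comm (ι N) 1ℚ) (sym (ι-suc N)) ⟩
    ι (suc N)                   ∎
    where open ℚP.≤-Reasoning

-- Truncated sums and the effect of appending an exponent.

partialSum-mono : ∀ {r} l (ks : Vec ℕ r) {m n} → m ℕ.≤ n → partialSum l ks m ℚ.≤ partialSum l ks n
partialSum-mono l []       m≤n = ℚP.≤-refl
partialSum-mono l (k ∷ ks) m≤n = increasing⇒≤ (partialSum l (k ∷ ks))
  (λ N → p≤p+q _ (0≤* (0≤weight (l ℕ.+ N) k) (0≤partialSum l ks (suc N)))) m≤n

-- The term with all variables equal to 1 already contributes 1.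
1≤partialSum : ∀ {r} (ks : Vec ℕ r) n → 1ℚ ℚ.≤ partialSum 0 ks (suc n)
1≤partialSum []       n = ℚP.≤-refl
1≤partialSum (k ∷ ks) n = ℚP.≤-trans
  (subst (1ℚ ℚ.≤_) (sym (trans (ℚP.+-identityˡ _) (trans (cong (ℚ._* _) (weight-base-1 k)) (ℚP.*-identityˡ _))))
    (1≤partialSum ks 0))
  (partialSum-mono 0 (k ∷ ks) (s≤s (z≤n {n})))

partialSum-∷ʳ-zero : ∀ {r} l (ks : Vec ℕ r) k → partialSum l (ks ∷ʳ k) 0 ≡ 0ℚ
partialSum-∷ʳ-zero l []       k = refl
partialSum-∷ʳ-zero l (x ∷ ks) k = refl

-- Splitting off the terms in which the innermost variable takes its least value l + 1.
partialSum-∷ʳ : ∀ {r} l (ks : Vec ℕ r) k N → partialSum l (ks ∷ʳ k) (suc N) ≡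
  partialSum (suc l) (ks ∷ʳ k) N ℚ.+ weight l k ℚ.* partialSum l ks (suc N)
partialSum-∷ʳ l [] k N = begin
  ∑ (suc N) f                      ≡⟨ ∑-head f N ⟩
  f 0 ℚ.+ ∑ N (λ i → f (suc i))    ≡⟨ ℚP.+-comm (f 0) _ ⟩
  ∑ N (λ i → f (suc i)) ℚ.+ f 0    ≡⟨ cong₂ ℚ._+_ (∑-cong (λ i → cong (λ n → weight n k ℚ.* 1ℚ) (ℕP.+-suc l i)) N)
                                        (cong (λ n → weight n k ℚ.* 1ℚ) (ℕP.+-identityʳ l)) ⟩
  ∑ N (λ i → weight (suc l ℕ.+ i) k ℚ.* 1ℚ) ℚ.+ weight l k ℚ.* 1ℚ ∎
  where
  open ≡-Reasoning
  f = λ i → weight (l ℕ.+ i) k ℚ.* 1ℚ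
partialSum-∷ʳ l (x ∷ ks) k N = begin
  ∑ (suc N) (λ i → w i ℚ.* partialSum l (ks ∷ʳ k) (suc i))
    ≡⟨ ∑-cong (λ i → trans (cong (w i ℚ.*_) (partialSum-∷ʳ l ks k i))
         (solve 4 (λ w p c s → w :* (p :+ c :* s) := w :* p :+ c :* (w :* s)) refl
           (w i) (partialSum (suc l) (ks ∷ʳ k) i) (weight l k) (partialSum l ks (suc i)))) (suc N) ⟩
  ∑ (suc N) (λ i → f i ℚ.+ weight l k ℚ.* g i)
    ≡⟨ ∑-linear f g (weight l k) (suc N) ⟩
  ∑ (suc N) f ℚ.+ weight l k ℚ.* ∑ (suc N) g
    ≡⟨ cong (ℚ._+ weight l k ℚ.* ∑ (suc N) g) (trans (∑-head f N)
         (trans (cong (ℚ._+ ∑ N (λ i → f (suc i))) f0≡0) (ℚP.+-identityˡ (∑ N (λ i → f (suc i)))))) ⟩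
  ∑ N (λ i → f (suc i)) ℚ.+ weight l k ℚ.* ∑ (suc N) g
    ≡⟨ cong (ℚ._+ weight l k ℚ.* ∑ (suc N) g)
         (∑-cong (λ i → cong (λ n → weight n x ℚ.* partialSum (suc l) (ks ∷ʳ k) (suc i)) (ℕP.+-suc l i)) N) ⟩
  partialSum (suc l) ((x ∷ ks) ∷ʳ k) N ℚ.+ weight l k ℚ.* partialSum l (x ∷ ks) (suc N) ∎
  where
  open ≡-Reasoning
  w = λ i → weight (l ℕ.+ i) x
  f = λ i → w i ℚ.* partialSum (suc l) (ks ∷ʳ k) i
  g = λ i → w i ℚ.* partialSum l ks (suc i)
  -- At i = 0 the inner upper limit is l + 1, which leaves no value above l + 1.
  f0≡0 : f 0 ≡ 0ℚ
  f0≡0 = trans (cong (w 0 ℚ.*_) (partialSum-∷ʳ-zero (suc l) ks k)) (ℚP.*-zeroʳ (w 0))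

-- The least value 1 of the innermost variable has weight 1, so the appended exponent contributes
-- exactly the tail from 2 on: the increment g_t. Raising the lower limit by one under the same
-- upper limit turns N + 1 into N.
partialSum-∷ʳ-0 : ∀ {r} (ks : Vec ℕ r) k N →
  partialSum 0 (ks ∷ʳ k) (suc N) ≡ partialSum 0 ks (suc N) ℚ.+ partialSum 1 (ks ∷ʳ k) N
partialSum-∷ʳ-0 ks k N = trans (partialSum-∷ʳ 0 ks k N) (trans
  (cong (partialSum 1 (ks ∷ʳ k) N ℚ.+_)
    (trans (cong (ℚ._* partialSum 0 ks (suc N)) (weight-base-1 k)) (ℚP.*-identityˡ _)))
  (ℚP.+-comm (partialSum 1 (ks ∷ʳ k) N) (partialSum 0 ks (suc N))))

ι*weight-suc : ∀ n k → ι (suc n) ℚ.* weight n (suc k) ≡ weight n k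
ι*weight-suc n k = begin
  ι (suc n) ℚ.* weight n (suc k)       ≡⟨ cong (ι (suc n) ℚ.*_) (weight-suc n k) ⟩
  ι (suc n) ℚ.* (u n ℚ.* weight n k)   ≡⟨ solve 3 (λ a b c → a :* (b :* c) := b :* a :* c) refl (ι (suc n)) (u n) (weight n k) ⟩
  u n ℚ.* ι (suc n) ℚ.* weight n k     ≡⟨ cong (ℚ._* weight n k) (u-ι n) ⟩
  1ℚ ℚ.* weight n k                    ≡⟨ ℚP.*-identityˡ (weight n k) ⟩
  weight n k                           ∎
  where open ≡-Reasoning

-- Tails of admissible vectors and bounds on the increments.

admissible-init : ∀ {r} (ks : Vec ℕ (suc r)) {k} → Admissible (ks ∷ʳ k) → Admissible ks × 1 ℕ.≤ k
admissible-init (x ∷ ks) (2≤x ∷ 1≤ks) = let 1≤ks , 1≤k = all-init ks 1≤ks in 2≤x ∷ 1≤ks , 1≤k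
  where
  all-init : ∀ {r} (ks : Vec ℕ r) {k} → All (1 ℕ.≤_) (ks ∷ʳ k) → All (1 ℕ.≤_) ks × 1 ℕ.≤ k
  all-init []       (1≤k ∷ []) = [] , 1≤k
  all-init (y ∷ ks) (1≤y ∷ hs) = let 1≤ks , 1≤k = all-init ks hs in 1≤y ∷ 1≤ks , 1≤k

admissible-∷ʳ : ∀ {r} {ks : Vec ℕ r} {k} → Admissible ks → 1 ℕ.≤ k → Admissible (ks ∷ʳ k)
admissible-∷ʳ (2≤x ∷ 1≤ks) 1≤k = 2≤x ∷ all-∷ʳ 1≤ks
  where
  all-∷ʳ : ∀ {r} {ks : Vec ℕ r} → All (1 ℕ.≤_) ks → All (1 ℕ.≤_) (ks ∷ʳ _)
  all-∷ʳ []       = 1≤k ∷ []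
  all-∷ʳ (h ∷ hs) = h ∷ all-∷ʳ hs

admissible⇒All : ∀ {r} {ks : Vec ℕ r} → Admissible ks → All (1 ℕ.≤_) ks
admissible⇒All (2≤k ∷ 1≤ks) = ℕP.≤-trans (s≤s z≤n) 2≤k ∷ 1≤ks

-- The induction appends exponents on the right, because `partialSum-∷ʳ` peels off the innermost
-- variable.
admissible-ind : (P : ∀ {r} → Vec ℕ r → Set) → (∀ c → P (suc (suc c) ∷ [])) →
  (∀ {r} {ks : Vec ℕ r} c → P ks → P (ks ∷ʳ suc c)) →
  ∀ {r} {ks : Vec ℕ r} → Admissible ks → P ks
admissible-ind P base step {suc r} = go r
  where
  go : ∀ r {ks : Vec ℕ (suc r)} → Admissible ks → P ks
  go zero    {suc (suc c) ∷ []} (s≤s (s≤s z≤n) ∷ []) = base c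
  go (suc r) {ks} adm with initLast ks
  ... | ks′ , k , refl with admissible-init ks′ adm
  ...   | adm′ , s≤s {n = c} z≤n = step c (go r adm′)

-- With m = l + 1 and f m the tail over n₁ ≥ ⋯ ≥ nᵣ ≥ m, this says that
-- m ^ (1 - c) f m decreases, and Decaying 0 is preserved by appending an exponent.
Decaying : ∀ {r} → ℕ → Vec ℕ r → Set
Decaying c ks = ∀ l N →
  ι (suc (suc l)) ℚ.* (weight (suc l) c ℚ.* partialSum (suc l) ks (suc N)) ℚ.≤
  ι (suc l) ℚ.* (weight l c ℚ.* partialSum l ks (suc (suc N)))

-- The tail of the empty vector is 1, so the product is m ^ (- c). `Decaying 0 []` would ask m
-- itself to decrease; this is where k₁ ≥ 2 enters.
decaying-[] : ∀ c → Decaying (suc c) []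
decaying-[] c l N = subst₂ ℚ._≤_ (eq (suc l)) (eq l) (weight-base-antimono c (ℕP.n≤1+n l))
  where
  eq : ∀ n → weight n c ≡ ι (suc n) ℚ.* (weight n (suc c) ℚ.* 1ℚ)
  eq n = sym (trans (cong (ι (suc n) ℚ.*_) (ℚP.*-identityʳ (weight n (suc c)))) (ι*weight-suc n c))

decaying-raise : ∀ {r} {ks : Vec ℕ r} → Decaying 0 ks → ∀ c → Decaying c ks
decaying-raise {ks = ks} dec c l N = begin
  ι (suc (suc l)) ℚ.* (weight (suc l) c ℚ.* g)   ≡⟨ swap (ι (suc (suc l))) (weight (suc l) c) g ⟩
  weight (suc l) c ℚ.* (ι (suc (suc l)) ℚ.* (1ℚ ℚ.* g))
    ≤⟨ *-mono-≤ (0≤weight (suc l) c) (0≤* (0≤ι (suc l)) (0≤* (0≤weight l 0) (0≤partialSum l ks (suc (suc N)))))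
         (weight-base-antimono c (ℕP.n≤1+n l)) (dec l N) ⟩
  weight l c ℚ.* (ι (suc l) ℚ.* (1ℚ ℚ.* h))      ≡⟨ sym (swap (ι (suc l)) (weight l c) h) ⟩
  ι (suc l) ℚ.* (weight l c ℚ.* h)               ∎
  where
  open ℚP.≤-Reasoning
  g = partialSum (suc l) ks (suc N)
  h = partialSum l ks (suc (suc N))
  swap : ∀ a b c → a ℚ.* (b ℚ.* c) ≡ b ℚ.* (a ℚ.* (1ℚ ℚ.* c))
  swap = solve 3 (λ a b c → a :* (b :* c) := b :* (a :* (con 1ℚ :* c))) refl

-- With a = ι (l + 1) and x = 1 / (1 + a) the step is g ≤ x a h ⇒ (1 + x) g ≤ (1 - x²) h.
tail-≤ : ∀ {r} {ks : Vec ℕ r} c → Decaying c ks → ∀ l N →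
  partialSum (suc l) (ks ∷ʳ suc c) N ℚ.≤ weight l c ℚ.* partialSum l ks (suc N)
tail-≤ {ks = ks} c dec l zero = subst (ℚ._≤ weight l c ℚ.* partialSum l ks 1)
  (sym (partialSum-∷ʳ-zero (suc l) ks (suc c))) (0≤* (0≤weight l c) (0≤partialSum l ks 1))
tail-≤ {ks = ks} c dec l (suc N) = begin
  partialSum (suc l) (ks ∷ʳ suc c) (suc N)
    ≡⟨ partialSum-∷ʳ (suc l) ks (suc c) N ⟩
  partialSum (suc (suc l)) (ks ∷ʳ suc c) N ℚ.+ weight (suc l) (suc c) ℚ.* t
    -- The recursion raises l while N drops: its bound at l + 1 is exactly g, and the term split off
    -- is x g.
    ≤⟨ ℚP.+-mono-≤ (tail-≤ {ks = ks} c dec (suc l) N)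
         (ℚP.≤-reflexive (trans (cong (ℚ._* t) (weight-suc (suc l) c)) (ℚP.*-assoc x (weight (suc l) c) t))) ⟩
  g ℚ.+ x ℚ.* g
    ≤⟨ ≤-by difference (0≤+ (0≤* (0≤+ (ℚP.nonNegative⁻¹ 1ℚ) 0≤x) (0≤* 0≤x (0≤q-p (dec l N)))) (0≤* (0≤* 0≤x 0≤x) 0≤h)) ⟩
  h ∎
  where
  open ℚP.≤-Reasoning
  t = partialSum (suc l) ks (suc N)
  a = ι (suc l)
  x = u (suc l)
  g = weight (suc l) c ℚ.* t
  h = weight l c ℚ.* partialSum l ks (suc (suc N))
  0≤x = 0≤u (suc l)
  0≤h = 0≤* (0≤weight l c) (0≤partialSum l ks (suc (suc N)))
  difference : h ℚ.- (g ℚ.+ x ℚ.* g) ≡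
    (1ℚ ℚ.+ x) ℚ.* (x ℚ.* (a ℚ.* h ℚ.- ι (suc (suc l)) ℚ.* g)) ℚ.+ x ℚ.* x ℚ.* h
  difference = begin-equality
    h ℚ.- (g ℚ.+ x ℚ.* g)
      ≡⟨ solve 3 (λ x g h → h :- (g :+ x :* g) := (con 1ℚ :+ x) :* ((con 1ℚ :- x) :* h :- con 1ℚ :* g) :+ x :* x :* h) refl x g h ⟩
    (1ℚ ℚ.+ x) ℚ.* ((1ℚ ℚ.- x) ℚ.* h ℚ.- 1ℚ ℚ.* g) ℚ.+ x ℚ.* x ℚ.* h
      ≡⟨ cong (λ e → (1ℚ ℚ.+ x) ℚ.* ((e ℚ.- x) ℚ.* h ℚ.- e ℚ.* g) ℚ.+ x ℚ.* x ℚ.* h)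
           (sym (trans (cong (x ℚ.*_) (sym (ι-suc (suc l)))) (u-ι (suc l)))) ⟩
    (1ℚ ℚ.+ x) ℚ.* ((x ℚ.* (1ℚ ℚ.+ a) ℚ.- x) ℚ.* h ℚ.- x ℚ.* (1ℚ ℚ.+ a) ℚ.* g) ℚ.+ x ℚ.* x ℚ.* h
      ≡⟨ solve 4 (λ a x g h → (con 1ℚ :+ x) :* ((x :* (con 1ℚ :+ a) :- x) :* h :- x :* (con 1ℚ :+ a) :* g) :+ x :* x :* h
                := (con 1ℚ :+ x) :* (x :* (a :* h :- (con 1ℚ :+ a) :* g)) :+ x :* x :* h) refl a x g h ⟩
    (1ℚ ℚ.+ x) ℚ.* (x ℚ.* (a ℚ.* h ℚ.- (1ℚ ℚ.+ a) ℚ.* g)) ℚ.+ x ℚ.* x ℚ.* h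
      ≡⟨ cong (λ z → (1ℚ ℚ.+ x) ℚ.* (x ℚ.* (a ℚ.* h ℚ.- z ℚ.* g)) ℚ.+ x ℚ.* x ℚ.* h) (sym (ι-suc (suc l))) ⟩
    (1ℚ ℚ.+ x) ℚ.* (x ℚ.* (a ℚ.* h ℚ.- ι (suc (suc l)) ℚ.* g)) ℚ.+ x ℚ.* x ℚ.* h ∎

-- Write F for the tail with the exponent appended. Then m F m - (m + 1) F (m + 1) = m ^ (- c) f m -
-- F (m + 1), which is nonnegative by `tail-≤`.
decaying-∷ʳ : ∀ {r} {ks : Vec ℕ r} c → Decaying c ks → Decaying 0 (ks ∷ʳ suc c)
decaying-∷ʳ {ks = ks} c dec l N = ≤-by difference (0≤q-p (tail-≤ {ks = ks} c dec l (suc N)))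
  where
  open ≡-Reasoning
  a = ι (suc l)
  t = partialSum (suc l) (ks ∷ʳ suc c) (suc N)
  h = partialSum l ks (suc (suc N))
  difference : a ℚ.* (1ℚ ℚ.* partialSum l (ks ∷ʳ suc c) (suc (suc N))) ℚ.- ι (suc (suc l)) ℚ.* (1ℚ ℚ.* t) ≡
    weight l c ℚ.* h ℚ.- t
  difference = begin
    a ℚ.* (1ℚ ℚ.* partialSum l (ks ∷ʳ suc c) (suc (suc N))) ℚ.- ι (suc (suc l)) ℚ.* (1ℚ ℚ.* t)
      ≡⟨ cong₂ (λ y z → a ℚ.* (1ℚ ℚ.* y) ℚ.- z ℚ.* (1ℚ ℚ.* t)) (partialSum-∷ʳ l ks (suc c) (suc N)) (ι-suc (suc l)) ⟩
    a ℚ.* (1ℚ ℚ.* (t ℚ.+ weight l (suc c) ℚ.* h)) ℚ.- (1ℚ ℚ.+ a) ℚ.* (1ℚ ℚ.* t)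
      ≡⟨ solve 4 (λ a t w h → a :* (con 1ℚ :* (t :+ w :* h)) :- (con 1ℚ :+ a) :* (con 1ℚ :* t) := a :* w :* h :- t) refl
           a t (weight l (suc c)) h ⟩
    a ℚ.* weight l (suc c) ℚ.* h ℚ.- t
      ≡⟨ cong (λ z → z ℚ.* h ℚ.- t) (ι*weight-suc l c) ⟩
    weight l c ℚ.* h ℚ.- t ∎

admissible⇒decaying : ∀ {r} {ks : Vec ℕ r} → Admissible ks → Decaying 0 ks
admissible⇒decaying = admissible-ind (λ ks → Decaying 0 ks) (λ c → decaying-∷ʳ {ks = []} (suc c) (decaying-[] c))
  λ {_} {ks} c dec → decaying-∷ʳ {ks = ks} c (decaying-raise {ks = ks} dec c)

-- The part with innermost variable n is at most 1 / (n (n - 1)): for depth 1 because the exponent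
-- is at least 2, otherwise because the remaining tail is at most 1 / (n - 1) by induction. Summing
-- over n ≥ l + 2 telescopes.
tail-≤u : ∀ {r} {ks : Vec ℕ r} → Admissible ks → ∀ l N → partialSum (suc l) ks N ℚ.≤ u l
tail-≤u = admissible-ind (λ ks → ∀ l N → partialSum (suc l) ks N ℚ.≤ u l)
  (λ c → step {ks = []} (suc c) λ l N → subst (ℚ._≤ u (suc l) ℚ.* u l) (sym (ℚP.*-identityʳ _))
    (ℚP.≤-trans (weight≤u² (suc l) {suc (suc c)} (s≤s (s≤s z≤n))) (*-monoˡ (0≤u (suc l)) (u-antimono l))))
  λ {_} {ks} c bound → step {ks = ks} c λ l N →
    *-mono-≤ (0≤weight (suc l) (suc c)) (0≤u l) (weight≤u (suc l) {suc c} (s≤s z≤n)) (bound l (suc N))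
  where
  step : ∀ {r} {ks : Vec ℕ r} c →
    (∀ l N → weight (suc l) (suc c) ℚ.* partialSum (suc l) ks (suc N) ℚ.≤ u (suc l) ℚ.* u l) →
    ∀ l N → partialSum (suc l) (ks ∷ʳ suc c) N ℚ.≤ u l
  step {ks = ks} c h l zero    = subst (ℚ._≤ u l) (sym (partialSum-∷ʳ-zero (suc l) ks (suc c))) (0≤u l)
  step {ks = ks} c h l (suc N) = subst₂ ℚ._≤_ (sym (partialSum-∷ʳ (suc l) ks (suc c) N)) (sym (u-suc l))
    (ℚP.+-mono-≤ (step {ks = ks} c h (suc l) N) (h l N))

-- The second weight comes from the innermost value 2, the first from `tail-≤` applied to the values
-- from 3 on.
increment-≤ : ∀ {r} {ks : Vec ℕ r} c → Decaying c ks → ∀ N →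
  partialSum 1 (ks ∷ʳ suc c) (suc N) ℚ.≤ (weight 1 c ℚ.+ weight 1 (suc c)) ℚ.* partialSum 1 ks (suc N)
increment-≤ {ks = ks} c dec N = subst₂ ℚ._≤_ (sym (partialSum-∷ʳ 1 ks (suc c) N))
  (sym (ℚP.*-distribʳ-+ (partialSum 1 ks (suc N)) (weight 1 c) (weight 1 (suc c))))
  (ℚP.+-monoˡ-≤ (weight 1 (suc c) ℚ.* partialSum 1 ks (suc N)) (tail-≤ {ks = ks} c dec 1 N))

increment-ratio : ∀ {r} {ks : Vec ℕ r} → Admissible ks → ∀ c N →
  partialSum 1 (ks ∷ʳ suc c) N ℚ.≤ partialSum 1 ks N ℚ.+ ½ ℚ.* partialSum 1 ks N
increment-ratio {ks = ks} adm c zero    = subst (ℚ._≤ _) (sym (partialSum-∷ʳ-zero 1 ks (suc c)))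
  (0≤+ (0≤partialSum 1 ks 0) (0≤* (ℚP.nonNegative⁻¹ ½) (0≤partialSum 1 ks 0)))
increment-ratio {ks = ks} adm c (suc N) = begin
  partialSum 1 (ks ∷ʳ suc c) (suc N)
    ≤⟨ increment-≤ {ks = ks} c (decaying-raise {ks = ks} (admissible⇒decaying adm) c) N ⟩
  (weight 1 c ℚ.+ weight 1 (suc c)) ℚ.* t
    -- The factor 2 ^ (- c) + 2 ^ (- c - 1) is largest at c = 0, where it is 3/2.
    ≤⟨ ℚP.*-monoʳ-≤-nonNeg t {{ℚ.nonNegative (0≤partialSum 1 ks (suc N))}}
         (ℚP.+-mono-≤ (weight-antimono 1 {0} {c} z≤n) (weight-antimono 1 {1} {suc c} (s≤s z≤n))) ⟩
  (1ℚ ℚ.+ ½) ℚ.* t   ≡⟨ solve 1 (λ t → (con 1ℚ :+ con ½) :* t := t :+ con ½ :* t) refl t ⟩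
  t ℚ.+ ½ ℚ.* t      ∎
  where
  open ℚP.≤-Reasoning
  t = partialSum 1 ks (suc N)

-- (3/2)x ≤ x + (3/4)y ≤ x + y when x ≤ (3/2)y.
gap-≤ : ∀ {r} {ks : Vec ℕ r} → Admissible ks → ∀ c d N →
  partialSum 1 (ks ∷ʳ suc c ∷ʳ suc d ∷ʳ 1) N ℚ.≤
  partialSum 0 (ks ∷ʳ suc c ∷ʳ suc d) (suc N) ℚ.- partialSum 0 ks (suc N)
gap-≤ {ks = ks} adm c d N = subst (g ℚ.≤_) (sym telescope)
  (≤-by (solve 3 (λ g x y → (y :+ x) :- g :=
      ((x :+ con ½ :* x) :- g) :+ (con ½ :* ((y :+ con ½ :* y) :- x) :+ con ½ :* (con ½ :* y))) refl g x y)
    (0≤+ (0≤q-p (increment-ratio (admissible-∷ʳ (admissible-∷ʳ adm (s≤s z≤n)) (s≤s z≤n)) 0 N))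
      (0≤+ (0≤* 0≤½ (0≤q-p (increment-ratio (admissible-∷ʳ adm (s≤s z≤n)) d N)))
        (0≤* 0≤½ (0≤* 0≤½ (0≤partialSum 1 (ks ∷ʳ suc c) N))))))
  where
  0≤½ = ℚP.nonNegative⁻¹ ½
  g = partialSum 1 (ks ∷ʳ suc c ∷ʳ suc d ∷ʳ 1) N
  x = partialSum 1 (ks ∷ʳ suc c ∷ʳ suc d) N
  y = partialSum 1 (ks ∷ʳ suc c) N
  z = partialSum 0 ks (suc N)
  telescope : partialSum 0 (ks ∷ʳ suc c ∷ʳ suc d) (suc N) ℚ.- z ≡ y ℚ.+ x
  telescope = trans (cong (ℚ._- z) (trans (partialSum-∷ʳ-0 (ks ∷ʳ suc c) (suc d) N)
      (cong (ℚ._+ x) (partialSum-∷ʳ-0 ks (suc c) N))))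
    (solve 3 (λ x y z → ((z :+ y) :+ x) :- z := y :+ x) refl x y z)

-- Lexicographic comparison of exponent vectors.

-- A larger exponent costs a factor of at least i + 1, which absorbs p. Thus the first differing
-- exponent decides a comparison, whatever exponents follow.
cross-≤ : ∀ {x y} → x ℕ.< y → ∀ i {p q} → p ℚ.≤ ι (suc i) → 1ℚ ℚ.≤ q →
  weight i y ℚ.* p ℚ.≤ weight i x ℚ.* q
cross-≤ {x} {y} x<y i {p} {q} p≤ι 1≤q = begin
  weight i y ℚ.* p               ≤⟨ *-mono-≤ (0≤weight i y) (0≤ι (suc i)) (weight-antimono i x<y) p≤ι ⟩
  weight i (suc x) ℚ.* ι (suc i) ≡⟨ trans (ℚP.*-comm (weight i (suc x)) (ι (suc i))) (ι*weight-suc i x) ⟩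
  weight i x                     ≡⟨ sym (ℚP.*-identityʳ (weight i x)) ⟩
  weight i x ℚ.* 1ℚ              ≤⟨ *-monoˡ (0≤weight i x) 1≤q ⟩
  weight i x ℚ.* q               ∎
  where open ℚP.≤-Reasoning

1≤ι-suc : ∀ n → 1ℚ ℚ.≤ ι (suc n)
1≤ι-suc n = subst (1ℚ ℚ.≤_) (sym (ι-suc n)) (p≤p+q 1ℚ (0≤ι n))

-- On the right, f stands for arbitrary further exponents appended to ks.
compare : ∀ {s t} (as : Vec ℕ s) (ks : Vec ℕ t) → s ℕ.≤ t → All (1 ℕ.≤_) as → All (1 ℕ.≤_) ks →
  (∀ n → partialSum 0 as (suc n) ℚ.≤ partialSum 0 ks (suc n)) ⊎
  (∀ f → (∀ n → f (suc n) ℚ.≤ ι (suc n)) → ∀ n → nested f ks (suc n) ℚ.≤ partialSum 0 as (suc n))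
compare []       ks       _         _            _            = inj₁ (1≤partialSum ks)
compare (a ∷ as) (k ∷ ks) (s≤s s≤t) (_ ∷ 1≤as) (_ ∷ 1≤ks) with ℕP.<-cmp a k
... | tri> _ _ k<a = inj₁ λ n → ∑-mono (λ i → cross-≤ k<a i
        (subst (ℚ._≤ ι (suc i)) (sym (partialSum≡nested as (suc i))) (nested-≤ι 1≤ι-suc 1≤as i))
        (1≤partialSum ks i)) (suc n)
... | tri< a<k _ _ = inj₂ λ f f≤ι n → ∑-mono (λ i →
        cross-≤ a<k i (nested-≤ι f≤ι 1≤ks i) (1≤partialSum as i)) (suc n)
... | tri≈ _ refl _ with compare as ks s≤t 1≤as 1≤ks
...   | inj₁ as≤ks = inj₁ λ n → ∑-mono (λ i → *-monoˡ (0≤weight i a) (as≤ks i)) (suc n)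
...   | inj₂ ks≤as = inj₂ λ f f≤ι n → ∑-mono (λ i → *-monoˡ (0≤weight i a) (ks≤as f f≤ι i)) (suc n)

gap-lower : ∀ {r s} {as : Vec ℕ s} {ks : Vec ℕ r} → s ℕ.≤ r → Admissible as → Admissible ks → ∀ c d n →
  let k = ks ∷ʳ suc c ∷ʳ suc d
      a-k = partialSum 0 as (suc n) ℚ.- partialSum 0 k (suc n)
  in partialSum 1 (k ∷ʳ 1) n ℚ.≤ ℚ.∣ a-k ∣
gap-lower {as = as} {ks} s≤r adm-as adm-ks c d n
  with compare as ks s≤r (admissible⇒All adm-as) (admissible⇒All adm-ks)
... | inj₁ as≤ks = begin
  partialSum 1 (k ∷ʳ 1) n                             ≤⟨ gap-≤ adm-ks c d n ⟩
  partialSum 0 k (suc n) ℚ.- partialSum 0 ks (suc n)  ≤⟨ ℚP.+-monoʳ-≤ (partialSum 0 k (suc n)) (ℚP.neg-antimono-≤ (as≤ks n)) ⟩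
  partialSum 0 k (suc n) ℚ.- partialSum 0 as (suc n)  ≤⟨ p≤∣p∣ _ ⟩
  ℚ.∣ partialSum 0 k (suc n) ℚ.- partialSum 0 as (suc n) ∣
    ≡⟨ ∣p-q∣≡∣q-p∣ (partialSum 0 k (suc n)) (partialSum 0 as (suc n)) ⟩
  ℚ.∣ partialSum 0 as (suc n) ℚ.- partialSum 0 k (suc n) ∣ ∎
  where
  open ℚP.≤-Reasoning
  k = ks ∷ʳ suc c ∷ʳ suc d
... | inj₂ ks≤as = ℚP.≤-trans
  (≤-by (solve 3 (λ g x y → (y :- x) :- g := y :- (x :+ g)) refl
      (partialSum 1 (k ∷ʳ 1) n) (partialSum 0 k (suc n)) (partialSum 0 as (suc n)))
    (0≤q-p (subst (ℚ._≤ partialSum 0 as (suc n)) (trans (sym extend) (partialSum-∷ʳ-0 k 1 n)) (ks≤as f f≤ι n))))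
  (p≤∣p∣ _)
  where
  k = ks ∷ʳ suc c ∷ʳ suc d
  -- With this f the second case of `compare` bounds the truncated sum of `k ∷ʳ 1`, that is, of k
  -- plus its gap.
  f = nested (λ _ → 1ℚ) (suc c ∷ suc d ∷ 1 ∷ [])
  f≤ι : ∀ n → f (suc n) ℚ.≤ ι (suc n)
  f≤ι = nested-≤ι {f = λ _ → 1ℚ} 1≤ι-suc {suc c ∷ suc d ∷ 1 ∷ []} (s≤s z≤n ∷ s≤s z≤n ∷ s≤s z≤n ∷ [])
  one = λ (_ : ℕ) → 1ℚ
  extend : partialSum 0 (k ∷ʳ 1) (suc n) ≡ nested f ks (suc n)
  extend = begin
    partialSum 0 (k ∷ʳ 1) (suc n)                               ≡⟨ partialSum≡nested (k ∷ʳ 1) (suc n) ⟩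
    nested one (k ∷ʳ 1) (suc n)                                 ≡⟨ nested-∷ʳ one k 1 (suc n) ⟩
    nested (nested one (1 ∷ [])) k (suc n)                      ≡⟨ nested-∷ʳ _ (ks ∷ʳ suc c) (suc d) (suc n) ⟩
    nested (nested one (suc d ∷ 1 ∷ [])) (ks ∷ʳ suc c) (suc n)  ≡⟨ nested-∷ʳ _ ks (suc c) (suc n) ⟩
    nested f ks (suc n)                                         ∎
    where open ≡-Reasoning

-- Bounded depth of close values for members of `𝒵⋆`.

¼ : ℚ
¼ = + 1 / 4

0<* : ∀ {p q} → 0ℚ ℚ.< p → 0ℚ ℚ.< q → 0ℚ ℚ.< p ℚ.* q
0<* {p} {q} 0<p 0<q = subst (ℚ._< p ℚ.* q) (ℚP.*-zeroˡ q) (ℚP.*-monoˡ-<-pos q {{ℚ.positive 0<q}} 0<p)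

0<ε*¼ : ∀ {ε} → 0ℚ ℚ.< ε → 0ℚ ℚ.< ε ℚ.* ¼
0<ε*¼ 0<ε = 0<* 0<ε (ℚP.positive⁻¹ ¼)

∣p-q∣<r⇒p-q≤r : ∀ p q {r} → ℚ.∣ p ℚ.- q ∣ ℚ.< r → p ℚ.- q ℚ.≤ r
∣p-q∣<r⇒p-q≤r p q h = ℚP.≤-trans (p≤∣p∣ (p ℚ.- q)) (ℚP.<⇒≤ h)

∣p-q∣<r⇒q-p≤r : ∀ p q {r} → ℚ.∣ p ℚ.- q ∣ ℚ.< r → q ℚ.- p ℚ.≤ r
∣p-q∣<r⇒q-p≤r p q h = ∣p-q∣<r⇒p-q≤r q p (subst (ℚ._< _) (∣p-q∣≡∣q-p∣ p q) h)

Close : ℝ → ℕ → Set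
Close α r = Σ[ k ∈ Vec ℕ r ] Σ[ adm ∈ Admissible k ] ∣ α - ζ⋆ k adm ∣ < gap k adm

-- The termwise comparison relates the gap at n to the values at n + 1, so the two
-- indices are reconciled by the Cauchy property of the gap.
∈⇒Fin : ∀ {α s} {as : Vec ℕ s} (adm : Admissible as) → α ≃ ζ⋆ as adm → Fin (Close α)
-- Depth s + 3 leaves, after the last two exponents are split off, a vector at least as long as
-- `as`.
∈⇒Fin {α} {suc s} {as} adm-as α≃ζ = suc (suc (suc s)) , λ { _ (s≤s (s≤s s≤t)) → apart s≤t }
  where
  apart : ∀ {t} → suc s ℕ.≤ t → ¬ Close α (suc (suc t))
  apart {suc t} s≤t (k₂ , adm₂ , close) with initLast k₂
  ... | k₁ , _ , refl with admissible-init k₁ adm₂ | initLast k₁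
  ...   | adm₁ , s≤s {n = d} z≤n | k₀ , _ , refl with admissible-init k₀ adm₁
  ...     | adm₀ , s≤s {n = c} z≤n = contra close
    where
    contra : ¬ (∣ α - ζ⋆ (k₀ ∷ʳ suc c ∷ʳ suc d) adm₂ ∣ < gap (k₀ ∷ʳ suc c ∷ʳ suc d) adm₂)
    contra (ε , 0<ε , N , h) with α≃ζ (ε ℚ.* ¼) (0<ε*¼ 0<ε)
      | cauchy (gap (k₀ ∷ʳ suc c ∷ʳ suc d) adm₂) (ε ℚ.* ¼) (0<ε*¼ 0<ε)
    ... | N₁ , near | N₂ , cau = ℚP.<-irrefl refl (ℚP.<-≤-trans 0<ε ε≤0)
      where
      n = N ℕ.⊔ (N₁ ℕ.⊔ N₂)
      N≤n = ℕP.m≤m⊔n N (N₁ ℕ.⊔ N₂)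
      N₁≤n = ℕP.≤-trans (ℕP.m≤m⊔n N₁ N₂) (ℕP.m≤n⊔m N (N₁ ℕ.⊔ N₂))
      N₂≤n = ℕP.≤-trans (ℕP.m≤n⊔m N₁ N₂) (ℕP.m≤n⊔m N (N₁ ℕ.⊔ N₂))
      k = k₀ ∷ʳ suc c ∷ʳ suc d
      x = seq α (suc n)
      y = partialSum 0 as (suc n)
      z = partialSum 0 k (suc n)
      g = partialSum 1 (k ∷ʳ 1)
      triangle : ℚ.∣ y ℚ.- z ∣ ℚ.≤ ℚ.∣ y ℚ.- x ∣ ℚ.+ ℚ.∣ x ℚ.- z ∣
      triangle = subst (λ w → ℚ.∣ w ∣ ℚ.≤ ℚ.∣ y ℚ.- x ∣ ℚ.+ ℚ.∣ x ℚ.- z ∣) (sym (p-r≡[p-q]+[q-r] y x z))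
        (ℚP.∣p+q∣≤∣p∣+∣q∣ (y ℚ.- x) (x ℚ.- z))
      near′ : ℚ.∣ y ℚ.- x ∣ ℚ.≤ ε ℚ.* ¼
      near′ = ℚP.<⇒≤ (subst (ℚ._< ε ℚ.* ¼) (∣p-q∣≡∣q-p∣ x y) (near (suc n) (ℕP.m≤n⇒m≤1+n N₁≤n)))
      ε≤0 : ε ℚ.≤ 0ℚ
      -- The five differences add up to - ε / 2: of the separation ε, one quarter is spent on
      -- replacing α by its star value and one on moving the gap from n + 1 to n.
      ε≤0 = ≤-by (solve 6 (λ e xz yx yz gn gn′ → con 0ℚ :- e :=
            let s = (gn′ :- (xz :+ e)) :+ ((e :* con ¼ :- (gn′ :- gn)) :+ ((yz :- gn) :+ (((yx :+ xz) :- yz) :+ (e :* con ¼ :- yx))))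
            in s :+ s) refl
          ε ℚ.∣ x ℚ.- z ∣ ℚ.∣ y ℚ.- x ∣ ℚ.∣ y ℚ.- z ∣ (g n) (g (suc n))) (0≤+ 0≤s 0≤s)
        where
        0≤s = 0≤+ (0≤q-p (h (suc n) (ℕP.m≤n⇒m≤1+n N≤n)))
          (0≤+ (0≤q-p (∣p-q∣<r⇒p-q≤r (g (suc n)) (g n) (cau (suc n) n (ℕP.m≤n⇒m≤1+n N₂≤n) N₂≤n)))
            (0≤+ (0≤q-p (gap-lower s≤t adm-as adm₀ c d n)) (0≤+ (0≤q-p triangle) (0≤q-p near′))))

-- Strict order on sequences.

infix 4 _≺_

-- This is `_<_` on bare sequences, so that divergent sums such as the harmonic series can be
-- compared as well.
_≺_ : (ℕ → ℚ) → (ℕ → ℚ) → Set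
x ≺ y = ∃[ ε ] 0ℚ ℚ.< ε × ∃[ N ] ∀ n → N ℕ.≤ n → x n ℚ.+ ε ℚ.≤ y n

≺-respʳ : ∀ {x y z} → (∀ n → y n ≡ z n) → x ≺ y → x ≺ z
≺-respʳ y≡z (ε , 0<ε , N , h) = ε , 0<ε , N , λ n N≤n → subst (_ ℚ.≤_) (y≡z n) (h n N≤n)

-- One decidable comparison at index N suffices. Beyond N both sequences stay within δ = ε / 5 of
-- their values there, so y N > x N + 3δ would separate them by δ for good; otherwise y - x is at
-- most 5δ.
⊀⇒≤ : ∀ {x y} → IsCauchy x → IsCauchy y → ¬ (x ≺ y) →
  ∀ ε → 0ℚ ℚ.< ε → ∃[ N ] ∀ n → N ℕ.≤ n → y n ℚ.- x n ℚ.≤ ε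
⊀⇒≤ {x} {y} cau-x cau-y x⊀y ε 0<ε = N , bound
  where
  δ = ε ℚ.* (+ 1 / 5)
  0<δ = 0<* 0<ε (ℚP.positive⁻¹ (+ 1 / 5))
  Nx = proj₁ (cau-x δ 0<δ)
  Ny = proj₁ (cau-y δ 0<δ)
  N = Nx ℕ.⊔ Ny
  x-near : ∀ n → N ℕ.≤ n → x n ℚ.- x N ℚ.≤ δ × x N ℚ.- x n ℚ.≤ δ
  x-near n N≤n = ∣p-q∣<r⇒p-q≤r (x n) (x N) h , ∣p-q∣<r⇒q-p≤r (x n) (x N) h
    where h = proj₂ (cau-x δ 0<δ) n N (ℕP.≤-trans (ℕP.m≤m⊔n Nx Ny) N≤n) (ℕP.m≤m⊔n Nx Ny)
  y-near : ∀ n → N ℕ.≤ n → y n ℚ.- y N ℚ.≤ δ × y N ℚ.- y n ℚ.≤ δ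
  y-near n N≤n = ∣p-q∣<r⇒p-q≤r (y n) (y N) h , ∣p-q∣<r⇒q-p≤r (y n) (y N) h
    where h = proj₂ (cau-y δ 0<δ) n N (ℕP.≤-trans (ℕP.m≤n⊔m Nx Ny) N≤n) (ℕP.m≤n⊔m Nx Ny)
  bound : ∀ n → N ℕ.≤ n → y n ℚ.- x n ℚ.≤ ε
  bound n N≤n with y N ℚP.≤? x N ℚ.+ (δ ℚ.+ δ ℚ.+ δ)
  ... | yes yN≤ = ≤-by
    (solve 5 (λ e a b c d → let δ = e :* con (+ 1 / 5) in e :- (d :- c) :=
      (a :+ (δ :+ δ :+ δ) :- b) :+ ((δ :- (d :- b)) :+ (δ :- (a :- c)))) refl ε (x N) (y N) (x n) (y n))
    (0≤+ (0≤q-p yN≤) (0≤+ (0≤q-p (proj₁ (y-near n N≤n))) (0≤q-p (proj₂ (x-near n N≤n)))))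
  ... | no yN≰ = contradiction (δ , 0<δ , N , λ m N≤m → ≤-by
    (solve 5 (λ δ a b c d → d :- (c :+ δ) :=
      (b :- (a :+ (δ :+ δ :+ δ))) :+ ((δ :- (b :- d)) :+ (δ :- (c :- a)))) refl δ (x N) (y N) (x m) (y m))
    (0≤+ (0≤q-p (ℚP.<⇒≤ (ℚP.≰⇒> yN≰))) (0≤+ (0≤q-p (proj₂ (y-near m N≤m))) (0≤q-p (proj₁ (x-near m N≤m))))))
    x⊀y

ε*¼<ε : ∀ {ε} → 0ℚ ℚ.< ε → ε ℚ.* ¼ ℚ.< ε
ε*¼<ε {ε} 0<ε = subst (ε ℚ.* ¼ ℚ.<_) (ℚP.*-identityʳ ε)
  (ℚP.*-monoʳ-<-pos ε {{ℚ.positive 0<ε}} (from-yes (¼ ℚP.<? 1ℚ)))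

⊀⊁⇒≃ : ∀ {x y} → ¬ (seq x ≺ seq y) → ¬ (seq y ≺ seq x) → x ≃ y
⊀⊁⇒≃ {x} {y} x⊀y y⊀x ε 0<ε with ⊀⇒≤ (cauchy x) (cauchy y) x⊀y (ε ℚ.* ¼) (0<ε*¼ 0<ε)
  | ⊀⇒≤ (cauchy y) (cauchy x) y⊀x (ε ℚ.* ¼) (0<ε*¼ 0<ε)
... | M , y-x≤ | N , x-y≤ = M ℕ.⊔ N , λ n M⊔N≤n → ℚP.≤-<-trans
  (∣p∣-bound (x-y≤ n (ℕP.≤-trans (ℕP.m≤n⊔m M N) M⊔N≤n))
    (subst (ℚ._≤ ε ℚ.* ¼) (solve 2 (λ a b → b :- a := :- (a :- b)) refl (seq x n) (seq y n))
      (y-x≤ n (ℕP.≤-trans (ℕP.m≤m⊔n M N) M⊔N≤n))))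
  (ε*¼<ε 0<ε)

-- Trailing ones.

n<2^n : ∀ n → n ℕ.< 2 ℕ.^ n
n<2^n zero    = s≤s z≤n
n<2^n (suc n) = ℕP.+-mono-≤ (ℕP.m^n>0 2 n) (ℕP.≤-trans (n<2^n n) (ℕP.m≤m+n (2 ℕ.^ n) 0))

-- `weight 1 j` is 2 ^ (- j), at most 1 / (j + 1), so the Archimedean property provides j.
weight-1-small : ∀ C ε → 0ℚ ℚ.≤ C → 0ℚ ℚ.< ε → ∃[ j ] weight 1 j ℚ.* C ℚ.≤ ε
weight-1-small C ε 0≤C 0<ε with archimedean (C ℚ.* (ℚ.1/ ε) {{ℚP.pos⇒nonZero ε {{ℚ.positive 0<ε}}}})
... | M , C/ε<ι = M , (begin
  weight 1 M ℚ.* C                   ≤⟨ ℚP.*-monoʳ-≤-nonNeg C {{ℚ.nonNegative 0≤C}}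
    (1/-antimono (suc M) (2 ℕ.^ M) {{_}} {{ℕP.m^n≢0 2 M}} (n<2^n M)) ⟩
  u M ℚ.* C                          ≡⟨ cong (u M ℚ.*_) (sym (trans (cong (C ℚ.*_) (ℚP.*-inverseˡ ε)) (ℚP.*-identityʳ C))) ⟩
  u M ℚ.* (C ℚ.* (ℚ.1/ ε ℚ.* ε))     ≡⟨ solve 4 (λ u c i e → u :* (c :* (i :* e)) := u :* e :* (c :* i)) refl (u M) C (ℚ.1/ ε) ε ⟩
  u M ℚ.* ε ℚ.* (C ℚ.* ℚ.1/ ε)       ≤⟨ *-monoˡ (0≤* (0≤u M) (ℚP.<⇒≤ 0<ε)) (ℚP.<⇒≤ (C/ε<ι M ℕP.≤-refl)) ⟩
  u M ℚ.* ε ℚ.* ι (suc M)            ≡⟨ solve 3 (λ u e i → u :* e :* i := u :* i :* e) refl (u M) ε (ι (suc M)) ⟩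
  u M ℚ.* ι (suc M) ℚ.* ε            ≡⟨ cong (ℚ._* ε) (u-ι M) ⟩
  1ℚ ℚ.* ε                           ≡⟨ ℚP.*-identityˡ ε ⟩
  ε                                  ∎)
  where
  open ℚP.≤-Reasoning
  instance _ = ℚP.pos⇒nonZero ε {{ℚ.positive 0<ε}}

ones : ℕ → ℕ → ℚ
ones j = partialSum 0 (replicate j 1)

-- n(n - 1) is the eigenfunction of f ↦ (n ↦ ∑_{i ≤ n} f i / i) with eigenvalue 1/2.
ones-lower : ∀ j N → ι N ℚ.≤ ones j N ℚ.+ weight 1 j ℚ.* (ι N ℚ.* (ι N ℚ.- 1ℚ))
ones-lower zero    zero    = ℚP.nonNegative⁻¹ 1ℚ
ones-lower zero    (suc N) = subst (λ z → z ℚ.≤ 1ℚ ℚ.+ 1ℚ ℚ.* (z ℚ.* (z ℚ.- 1ℚ))) (sym (ι-suc N))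
  (≤-by (solve 1 (λ x → (con 1ℚ :+ con 1ℚ :* ((con 1ℚ :+ x) :* ((con 1ℚ :+ x) :- con 1ℚ))) :- (con 1ℚ :+ x) := x :* x) refl (ι N))
    (0≤* (0≤ι N) (0≤ι N)))
ones-lower (suc j) zero    = ℚP.≤-reflexive
  (solve 1 (λ w → con 0ℚ := con 0ℚ :+ w :* (con 0ℚ :* (con 0ℚ :- con 1ℚ))) refl (weight 1 (suc j)))
ones-lower (suc j) (suc N) = ≤-by difference
  (0≤+ (0≤q-p (ones-lower (suc j) N)) (0≤* (0≤weight N 1) (0≤q-p (ones-lower j (suc N)))))
  where
  open ≡-Reasoning
  x = ι N
  v = weight N 1
  w = weight 1 j
  a = ones (suc j) N
  b = ones j (suc N)
  1≡v[1+x] : 1ℚ ≡ v ℚ.* (1ℚ ℚ.+ x)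
  1≡v[1+x] = sym (trans (cong₂ ℚ._*_ (weight-1 N) (sym (ι-suc N))) (u-ι N))
  difference : (a ℚ.+ v ℚ.* b) ℚ.+ weight 1 (suc j) ℚ.* (ι (suc N) ℚ.* (ι (suc N) ℚ.- 1ℚ)) ℚ.- ι (suc N) ≡
    (a ℚ.+ weight 1 (suc j) ℚ.* (x ℚ.* (x ℚ.- 1ℚ)) ℚ.- x) ℚ.+
    v ℚ.* (b ℚ.+ w ℚ.* (ι (suc N) ℚ.* (ι (suc N) ℚ.- 1ℚ)) ℚ.- ι (suc N))
  difference = begin
    (a ℚ.+ v ℚ.* b) ℚ.+ weight 1 (suc j) ℚ.* (ι (suc N) ℚ.* (ι (suc N) ℚ.- 1ℚ)) ℚ.- ι (suc N)
      ≡⟨ cong₂ (λ w z → (a ℚ.+ v ℚ.* b) ℚ.+ w ℚ.* (z ℚ.* (z ℚ.- 1ℚ)) ℚ.- z) (weight-suc 1 j) (ι-suc N) ⟩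
    (a ℚ.+ v ℚ.* b) ℚ.+ (½ ℚ.* w) ℚ.* ((1ℚ ℚ.+ x) ℚ.* ((1ℚ ℚ.+ x) ℚ.- 1ℚ)) ℚ.- (1ℚ ℚ.+ x)
      ≡⟨ solve 5 (λ a b v w x →
           (a :+ v :* b) :+ (con ½ :* w) :* ((con 1ℚ :+ x) :* ((con 1ℚ :+ x) :- con 1ℚ)) :- (con 1ℚ :+ x) :=
           (a :+ v :* b) :+ (con ½ :* w) :* (x :* (x :- con 1ℚ)) :+ w :* x :* con 1ℚ :- (con 1ℚ :+ x)) refl a b v w x ⟩
    (a ℚ.+ v ℚ.* b) ℚ.+ (½ ℚ.* w) ℚ.* (x ℚ.* (x ℚ.- 1ℚ)) ℚ.+ w ℚ.* x ℚ.* 1ℚ ℚ.- (1ℚ ℚ.+ x)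
      ≡⟨ cong (λ e → (a ℚ.+ v ℚ.* b) ℚ.+ (½ ℚ.* w) ℚ.* (x ℚ.* (x ℚ.- 1ℚ)) ℚ.+ w ℚ.* x ℚ.* e ℚ.- (e ℚ.+ x)) 1≡v[1+x] ⟩
    (a ℚ.+ v ℚ.* b) ℚ.+ (½ ℚ.* w) ℚ.* (x ℚ.* (x ℚ.- 1ℚ)) ℚ.+ w ℚ.* x ℚ.* (v ℚ.* (1ℚ ℚ.+ x)) ℚ.- (v ℚ.* (1ℚ ℚ.+ x) ℚ.+ x)
      ≡⟨ solve 5 (λ a b v w x →
           (a :+ v :* b) :+ (con ½ :* w) :* (x :* (x :- con 1ℚ)) :+ w :* x :* (v :* (con 1ℚ :+ x)) :- (v :* (con 1ℚ :+ x) :+ x) :=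
           (a :+ (con ½ :* w) :* (x :* (x :- con 1ℚ)) :- x) :+
           v :* (b :+ w :* ((con 1ℚ :+ x) :* ((con 1ℚ :+ x) :- con 1ℚ)) :- (con 1ℚ :+ x))) refl a b v w x ⟩
    (a ℚ.+ (½ ℚ.* w) ℚ.* (x ℚ.* (x ℚ.- 1ℚ)) ℚ.- x) ℚ.+
    v ℚ.* (b ℚ.+ w ℚ.* ((1ℚ ℚ.+ x) ℚ.* ((1ℚ ℚ.+ x) ℚ.- 1ℚ)) ℚ.- (1ℚ ℚ.+ x))
      ≡⟨ cong₂ (λ w′ z → (a ℚ.+ w′ ℚ.* (x ℚ.* (x ℚ.- 1ℚ)) ℚ.- x) ℚ.+ v ℚ.* (b ℚ.+ w ℚ.* (z ℚ.* (z ℚ.- 1ℚ)) ℚ.- z))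
           (sym (weight-suc 1 j)) (sym (ι-suc N)) ⟩
    (a ℚ.+ weight 1 (suc j) ℚ.* (x ℚ.* (x ℚ.- 1ℚ)) ℚ.- x) ℚ.+
    v ℚ.* (b ℚ.+ w ℚ.* (ι (suc N) ℚ.* (ι (suc N) ℚ.- 1ℚ)) ℚ.- ι (suc N)) ∎

nested-partialSum : ∀ {r s} (js : Vec ℕ s) (ks : Vec ℕ r) N → nested (partialSum 0 js) ks N ≡ partialSum 0 (ks ++ js) N
nested-partialSum js []       N = refl
nested-partialSum js (k ∷ ks) N = ∑-cong (λ i → cong (weight i k ℚ.*_) (nested-partialSum js ks (suc i))) N

nested-ones-∷ʳ : ∀ {r} j (ks : Vec ℕ r) N → nested (ones j) (ks ∷ʳ 1) N ≡ nested (ones (suc j)) ks N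
nested-ones-∷ʳ j ks N = nested-∷ʳ (ones j) ks 1 N

-- The factor n from `ι` cancels one power of the innermost variable. Since `ι` is the limit of
-- `ones j`, a tail of ones lowers the last exponent by one.
nested-ι-∷ʳ : ∀ {r} (ks : Vec ℕ r) c N → nested ι (ks ∷ʳ suc c) N ≡ partialSum 0 (ks ∷ʳ c) N
nested-ι-∷ʳ ks c N = begin
  nested ι (ks ∷ʳ suc c) N                 ≡⟨ nested-∷ʳ ι ks (suc c) N ⟩
  nested (nested ι (suc c ∷ [])) ks N      ≡⟨ nested-cong (∑-cong λ i →
    trans (ℚP.*-comm (weight i (suc c)) (ι (suc i))) (trans (ι*weight-suc i c) (sym (ℚP.*-identityʳ (weight i c))))) ks N ⟩
  nested (nested one (c ∷ [])) ks N        ≡⟨ sym (nested-∷ʳ one ks c N) ⟩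
  nested one (ks ∷ʳ c) N                   ≡⟨ sym (partialSum≡nested (ks ∷ʳ c) N) ⟩
  partialSum 0 (ks ∷ʳ c) N                 ∎
  where
  open ≡-Reasoning
  one = λ (_ : ℕ) → 1ℚ

-- The sums with exponents (ks, c + 1, 1, …, 1) approach the sum with exponents (ks, c).
≺-ones : ∀ {r x} → IsCauchy x → (ks : Vec ℕ r) → ∀ c → x ≺ partialSum 0 (ks ∷ʳ c) →
  ∃[ j ] x ≺ nested (ones j) (ks ∷ʳ suc c)
≺-ones {x = x} cau ks c (ε , 0<ε , N₀ , h) with cau (ε ℚ.* ¼) (0<ε*¼ 0<ε)
... | N₁ , near = j , δ , 0<ε*¼ 0<ε , n , λ m n≤m → ≤-by
      (solve 6 (λ e a b s t i → t :- (b :+ e :* con ¼) :=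
         (s :- (a :+ e)) :+ ((i :- s) :+ ((t :+ e :* con ¼ :- i) :+ ((e :* con ¼ :- (b :- a)) :+ e :* con ¼))))
         refl ε (x n) (x m) (partialSum 0 (ks ∷ʳ c) n) (nested (ones j) k m) (nested ι k n))
      (0≤+ (0≤q-p (h n N₀≤n)) (0≤+ (0≤q-p (ℚP.≤-reflexive (sym (nested-ι-∷ʳ ks c n))))
        (0≤+ (0≤q-p (approx m n≤m)) (0≤+ (0≤q-p (∣p-q∣<r⇒p-q≤r (x m) (x n) (near m n (ℕP.≤-trans N₁≤n n≤m) N₁≤n)))
          (ℚP.<⇒≤ (0<ε*¼ 0<ε))))))
  where
  open ℚP.≤-Reasoning
  δ = ε ℚ.* ¼
  k = ks ∷ʳ suc c
  n = suc (N₀ ℕ.⊔ N₁)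
  N₀≤n = ℕP.m≤n⇒m≤1+n (ℕP.m≤m⊔n N₀ N₁)
  N₁≤n = ℕP.m≤n⇒m≤1+n (ℕP.m≤n⊔m N₀ N₁)
  b : ℕ → ℚ
  b i = ι i ℚ.* (ι i ℚ.- 1ℚ)
  C = nested b k n
  -- The truncation n is fixed before j, so the error term of `ones-lower` can be made at most δ
  -- although C depends on n. Larger truncations m only add nonnegative terms.
  small = weight-1-small ℚ.∣ C ∣ δ (ℚP.0≤∣p∣ C) (0<ε*¼ 0<ε)
  j = proj₁ small
  approx : ∀ m → n ℕ.≤ m → nested ι k n ℚ.≤ nested (ones j) k m ℚ.+ δ
  approx m n≤m = begin
    nested ι k n                                      ≤⟨ nested-mono (λ i → ones-lower j (suc i)) k (N₀ ℕ.⊔ N₁) ⟩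
    nested (λ i → ones j i ℚ.+ weight 1 j ℚ.* b i) k n  ≡⟨ nested-linear (ones j) b (weight 1 j) k n ⟩
    nested (ones j) k n ℚ.+ weight 1 j ℚ.* C          ≤⟨ ℚP.+-mono-≤
      (subst₂ ℚ._≤_ (sym (nested-partialSum (replicate j 1) k n)) (sym (nested-partialSum (replicate j 1) k m))
        (partialSum-mono 0 (k ++ replicate j 1) n≤m))
      (ℚP.≤-trans (*-monoˡ (0≤weight 1 j) (p≤∣p∣ C)) (proj₂ small)) ⟩
    nested (ones j) k m ℚ.+ δ                         ∎

-- Choice of the next exponent.

-- The empty vector is included so that choosing the first exponent is an instance of choosing the
-- next one.
data Stem : ∀ {r} → Vec ℕ r → Set where
  []   : Stem []
  stem : ∀ {r} {ks : Vec ℕ r} → Admissible ks → Stem ks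

stem-∷ʳ : ∀ {r} {ks : Vec ℕ r} → Stem ks → ∀ c → Admissible (ks ∷ʳ suc (suc c))
stem-∷ʳ []         c = s≤s (s≤s z≤n) ∷ []
stem-∷ʳ (stem adm) c = admissible-∷ʳ adm (s≤s z≤n)

-- The tail of a stem from 2 on is at most 1, and the factor from `increment-≤` is at most 2 · 2 ^
-- (- c - 1). Hence the increment vanishes as c grows.
stem-tail : ∀ {r} {ks : Vec ℕ r} → Stem ks → ∀ c N →
  partialSum 1 (ks ∷ʳ suc (suc c)) (suc N) ℚ.≤ weight 1 c
stem-tail {ks = ks} st c N = begin
  partialSum 1 (ks ∷ʳ suc (suc c)) (suc N)
    ≤⟨ increment-≤ {ks = ks} (suc c) (decaying st) N ⟩
  (weight 1 (suc c) ℚ.+ weight 1 (suc (suc c))) ℚ.* partialSum 1 ks (suc N)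
    ≤⟨ *-mono-≤ (0≤+ (0≤weight 1 (suc c)) (0≤weight 1 (suc (suc c)))) (ℚP.nonNegative⁻¹ 1ℚ)
         (ℚP.+-monoʳ-≤ (weight 1 (suc c)) (weight-antimono 1 (ℕP.n≤1+n (suc c)))) (bound st) ⟩
  (weight 1 (suc c) ℚ.+ weight 1 (suc c)) ℚ.* 1ℚ
    ≡⟨ cong (λ w → (w ℚ.+ w) ℚ.* 1ℚ) (weight-suc 1 c) ⟩
  (½ ℚ.* weight 1 c ℚ.+ ½ ℚ.* weight 1 c) ℚ.* 1ℚ
    ≡⟨ solve 1 (λ w → (con ½ :* w :+ con ½ :* w) :* con 1ℚ := w) refl (weight 1 c) ⟩
  weight 1 c ∎
  where
  open ℚP.≤-Reasoning
  decaying : ∀ {r} {ks : Vec ℕ r} → Stem ks → Decaying (suc c) ks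
  decaying []                   = decaying-[] c
  decaying (stem {ks = ks} adm) = decaying-raise {ks = ks} (admissible⇒decaying adm) (suc c)
  bound : ∀ {r} {ks : Vec ℕ r} → Stem ks → partialSum 1 ks (suc N) ℚ.≤ 1ℚ
  bound []         = ℚP.≤-refl
  bound (stem adm) = tail-≤u adm 0 (suc N)

≺⇒bounded-digit : ∀ {r x} {ks : Vec ℕ r} → Stem ks → partialSum 0 ks ≺ x →
  ∃[ c ] ¬ (x ≺ partialSum 0 (ks ∷ʳ suc (suc c)))
≺⇒bounded-digit {x = x} {ks} st (ε , 0<ε , N , h) =
  c , λ { (δ , 0<δ , M , g) → ℚP.<-irrefl refl (ℚP.<-≤-trans 0<δ (δ≤0 δ M g)) }
  where
  small = weight-1-small 1ℚ ε (ℚP.nonNegative⁻¹ 1ℚ) 0<ε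
  c = proj₁ small
  k = ks ∷ʳ suc (suc c)
  arith : ∀ {a s t w δ} → a ℚ.+ δ ℚ.≤ s ℚ.+ t → s ℚ.+ ε ℚ.≤ a → t ℚ.≤ w → w ℚ.* 1ℚ ℚ.≤ ε → δ ℚ.≤ 0ℚ
  arith {a} {s} {t} {w} {δ} h₁ h₂ h₃ h₄ = ≤-by
    (solve 6 (λ d e a s t w → con 0ℚ :- d :=
      ((s :+ t) :- (a :+ d)) :+ ((a :- (s :+ e)) :+ ((w :- t) :+ (e :- w :* con 1ℚ)))) refl δ ε a s t w)
    (0≤+ (0≤q-p h₁) (0≤+ (0≤q-p h₂) (0≤+ (0≤q-p h₃) (0≤q-p h₄))))
  δ≤0 : ∀ δ M → (∀ n → M ℕ.≤ n → x n ℚ.+ δ ℚ.≤ partialSum 0 k n) → δ ℚ.≤ 0ℚ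
  δ≤0 δ M g = arith {s = partialSum 0 ks n} (subst (x n ℚ.+ δ ℚ.≤_) (partialSum-∷ʳ-0 ks (suc (suc c)) (suc m)) (g n M≤n))
      (h n N≤n) (stem-tail st c m) (proj₂ small)
    where
    m = N ℕ.⊔ M
    n = suc (suc m)
    N≤n = ℕP.m≤n⇒m≤1+n (ℕP.m≤n⇒m≤1+n (ℕP.m≤m⊔n N M))
    M≤n = ℕP.m≤n⇒m≤1+n (ℕP.m≤n⇒m≤1+n (ℕP.m≤n⊔m N M))

-- The next exponent of the expansion of x is bounded, because the sums with
-- exponents (ks, c) tend to the sum with exponents ks as c → ∞.
next-digit : ∀ {r x} {ks : Vec ℕ r} → IsCauchy x → Stem ks → x ≺ partialSum 0 (ks ∷ʳ 1) →
  (∀ c → let k = ks ∷ʳ suc (suc c) in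
    ¬ (x ≺ partialSum 0 k) → ¬ (∀ j → ¬ (x ≺ nested (ones j) k)) → ⊥) →
  ¬ (partialSum 0 ks ≺ x)
next-digit {x = x} {ks} cau st x≺1 rec ks≺x =
  let c , x⊀ = ≺⇒bounded-digit st ks≺x in below (suc c) x⊀
  where
  -- Descent to the least exponent whose sum does not exceed x. If this is c + 2, then x is below
  -- the sum for c + 1, and `≺-ones` shows that appended ones overshoot x, as `rec` requires. The
  -- case distinctions on `_≺_` take place under a double negation.
  below : ∀ c → ¬ ¬ (x ≺ partialSum 0 (ks ∷ʳ suc c))
  below zero    x⊀ = x⊀ x≺1
  below (suc c) x⊀ = below c λ x≺ → rec c x⊀ λ none →
    let j , x≺ones = ≺-ones {x = x} cau ks (suc c) x≺ in none j x≺ones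

-- Terms N + 2, …, 2N + 2 of the harmonic series are at least 1 / (2N + 2).
∑u-unbounded : ∀ m → ∃[ N ] ι m ℚ.≤ ∑ (suc N) u ℚ.+ ∑ (suc N) u
∑u-unbounded zero    = 0 , ℚP.nonNegative⁻¹ _
∑u-unbounded (suc m) with ∑u-unbounded m
... | N , m≤ = N ℕ.+ suc N , (begin
  ι (suc m)                                ≡⟨ ι-suc m ⟩
  1ℚ ℚ.+ ι m                               ≤⟨ ℚP.+-monoʳ-≤ 1ℚ m≤ ⟩
  1ℚ ℚ.+ (S ℚ.+ S)                         ≡⟨ cong (ℚ._+ (S ℚ.+ S)) (sym double) ⟩
  (y ℚ.+ y) ℚ.+ (S ℚ.+ S)                  ≡⟨ solve 2 (λ y s → (y :+ y) :+ (s :+ s) := (s :+ y) :+ (s :+ y)) refl y S ⟩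
  (S ℚ.+ y) ℚ.+ (S ℚ.+ y)                  ≤⟨ ℚP.+-mono-≤ (block (suc N) ℕP.≤-refl) (block (suc N) ℕP.≤-refl) ⟩
  ∑ (suc N ℕ.+ suc N) u ℚ.+ ∑ (suc N ℕ.+ suc N) u ∎)
  where
  open ℚP.≤-Reasoning
  S = ∑ (suc N) u
  d = u (N ℕ.+ suc N)
  y = ι (suc N) ℚ.* d
  double : y ℚ.+ y ≡ 1ℚ
  double = begin-equality
    y ℚ.+ y                                  ≡⟨ solve 2 (λ a d → a :* d :+ a :* d := d :* (a :+ a)) refl (ι (suc N)) d ⟩
    d ℚ.* (ι (suc N) ℚ.+ ι (suc N))          ≡⟨ cong (d ℚ.*_) (sym (ι-+ (suc N) (suc N))) ⟩
    d ℚ.* ι (suc N ℕ.+ suc N)                ≡⟨ u-ι (N ℕ.+ suc N) ⟩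
    1ℚ                                       ∎
  block : ∀ M → M ℕ.≤ suc N → S ℚ.+ ι M ℚ.* d ℚ.≤ ∑ (M ℕ.+ suc N) u
  block zero    _   = ℚP.≤-reflexive (trans (cong (S ℚ.+_) (ℚP.*-zeroˡ d)) (ℚP.+-identityʳ S))
  block (suc M) M<N = begin
    S ℚ.+ ι (suc M) ℚ.* d             ≡⟨ cong (λ z → S ℚ.+ z ℚ.* d) (ι-suc M) ⟩
    S ℚ.+ (1ℚ ℚ.+ ι M) ℚ.* d          ≡⟨ solve 3 (λ s m d → s :+ (con 1ℚ :+ m) :* d := (s :+ m :* d) :+ d) refl S (ι M) d ⟩
    (S ℚ.+ ι M ℚ.* d) ℚ.+ d           ≤⟨ ℚP.+-mono-≤ (block M (ℕP.<⇒≤ M<N))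
      (1/-antimono (suc (M ℕ.+ suc N)) (suc N ℕ.+ suc N) (ℕP.+-monoˡ-≤ (suc N) M<N)) ⟩
    ∑ (suc M ℕ.+ suc N) u             ∎

-- Starts the choice of the first exponent: exponent 1 overshoots every Cauchy sequence, so the
-- descent in `next-digit` ends at an exponent of at least 2.
≺harmonic : ∀ {x} → IsCauchy x → x ≺ partialSum 0 (1 ∷ [])
≺harmonic {x} cau = 1ℚ , ℚP.positive⁻¹ 1ℚ , N ℕ.⊔ suc K , λ n N⊔K≤n → arith {x N} {x n}
  (ℚP.<⇒≤ (proj₂ large M ℕP.≤-refl)) (proj₂ (∑u-unbounded (suc M)))
  (∣p-q∣<r⇒p-q≤r (x n) (x N) (proj₂ (cau 1ℚ 0<1) n N (ℕP.≤-trans (ℕP.m≤m⊔n N (suc K)) N⊔K≤n) ℕP.≤-refl))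
  (ℚP.≤-reflexive (∑-cong (λ i → sym (trans (ℚP.*-identityʳ (weight i 1)) (weight-1 i))) (suc K)))
  (partialSum-mono 0 (1 ∷ []) (ℕP.≤-trans (ℕP.m≤n⊔m N (suc K)) N⊔K≤n))
  where
  0<1 = ℚP.positive⁻¹ 1ℚ
  2ℚ = 1ℚ ℚ.+ 1ℚ
  N = proj₁ (cau 1ℚ 0<1)
  -- One unit covers the drift of x beyond N, the other the separation; the whole is doubled because
  -- `∑u-unbounded` bounds twice the harmonic sum.
  large = archimedean ((x N ℚ.+ 2ℚ) ℚ.+ (x N ℚ.+ 2ℚ))
  M = proj₁ large
  K = proj₁ (∑u-unbounded (suc M))
  arith : ∀ {a b i s z t} → (a ℚ.+ 2ℚ) ℚ.+ (a ℚ.+ 2ℚ) ℚ.≤ i → i ℚ.≤ s ℚ.+ s → b ℚ.- a ℚ.≤ 1ℚ →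
    s ℚ.≤ z → z ℚ.≤ t → b ℚ.+ 1ℚ ℚ.≤ t
  arith {a} {b} {i} {s} {z} {t} h₁ h₂ h₃ h₄ h₅ = ≤-by
    (solve 6 (λ a b i s z t → t :- (b :+ con 1ℚ) :=
       con ½ :* ((i :- ((a :+ con 2ℚ) :+ (a :+ con 2ℚ))) :+ ((s :+ s) :- i))
         :+ ((con 1ℚ :- (b :- a)) :+ ((z :- s) :+ (t :- z)))) refl a b i s z t)
    (0≤+ (0≤* (ℚP.nonNegative⁻¹ ½) (0≤+ (0≤q-p h₁) (0≤q-p h₂)))
      (0≤+ (0≤q-p h₃) (0≤+ (0≤q-p h₄) (0≤q-p h₅))))

-- Unbounded depth of close values for α outside `𝒵⋆`.

-- If α ≥ ζ⋆(k) is not close to ζ⋆(k), then the next exponent in the expansion of α is 1.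
⊀-∷ʳ1 : ∀ {α r} {ks : Vec ℕ r} (adm : Admissible ks) → ¬ (∣ α - ζ⋆ ks adm ∣ < gap ks adm) →
  ¬ (seq α ≺ partialSum 0 ks) → ¬ (seq α ≺ partialSum 0 (ks ∷ʳ 1))
⊀-∷ʳ1 {α} {ks = ks} adm not-close α⊀ (ε , 0<ε , N , h)
  with ⊀⇒≤ {seq α} {partialSum 0 ks} (cauchy α) (cauchy (ζ⋆ ks adm)) α⊀ (ε ℚ.* ¼) (0<ε*¼ 0<ε)
-- That α is at least the star value is known only up to ε / 4, and this error enters twice, which
-- leaves ε / 2 of the separation.
... | M , ζ-α≤ = not-close (ε ℚ.* ½ , 0<* 0<ε (ℚP.positive⁻¹ ½) , suc (N ℕ.⊔ M) , close)
  where
  arith : ∀ {a z g} → a ℚ.+ ε ℚ.- z ℚ.≤ g → z ℚ.- a ℚ.≤ ε ℚ.* ¼ → ℚ.∣ a ℚ.- z ∣ ℚ.+ ε ℚ.* ½ ℚ.≤ g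
  arith {a} {z} {g} h₁ h₂ = ≤-by
    (solve 3 (λ g d e → g :- (d :+ e) := (g :- e) :- d) refl g ℚ.∣ a ℚ.- z ∣ (ε ℚ.* ½))
    (0≤q-p (∣p∣-bound {a ℚ.- z} {g ℚ.- ε ℚ.* ½}
      (≤-by (solve 4 (λ a z e g → (g :- e :* con ½) :- (a :- z) := (g :- (a :+ e :- z)) :+ e :* con ½) refl a z ε g)
        (0≤+ (0≤q-p h₁) (ℚP.<⇒≤ (0<* 0<ε (ℚP.positive⁻¹ ½)))))
      (≤-by (solve 4 (λ a z e g → (g :- e :* con ½) :- (:- (a :- z)) :=
              (g :- (a :+ e :- z)) :+ ((e :* con ¼ :- (z :- a)) :+ (e :* con ¼ :- (z :- a)))) refl a z ε g)
        (0≤+ (0≤q-p h₁) (0≤+ (0≤q-p h₂) (0≤q-p h₂))))))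
  close : ∀ n → suc (N ℕ.⊔ M) ℕ.≤ n →
    ℚ.∣ seq α n ℚ.- partialSum 0 ks n ∣ ℚ.+ ε ℚ.* ½ ℚ.≤ partialSum 1 (ks ∷ʳ 1) n
  close (suc n) (s≤s N⊔M≤n) = arith {seq α (suc n)} {partialSum 0 ks (suc n)} {partialSum 1 (ks ∷ʳ 1) (suc n)} above
    (ζ-α≤ (suc n) (ℕP.m≤n⇒m≤1+n (ℕP.≤-trans (ℕP.m≤n⊔m N M) N⊔M≤n)))
    where
    a = seq α (suc n)
    z = partialSum 0 ks (suc n)
    g = partialSum 1 (ks ∷ʳ 1) (suc n)
    above : a ℚ.+ ε ℚ.- z ℚ.≤ g
    above = ≤-by (solve 5 (λ a e z g g′ → g :- (a :+ e :- z) := (g :- g′) :+ ((z :+ g′) :- (a :+ e))) refl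
        a ε z g (partialSum 1 (ks ∷ʳ 1) n))
      (0≤+ (0≤q-p (partialSum-mono 1 (ks ∷ʳ 1) (ℕP.n≤1+n n)))
        (0≤q-p (subst (a ℚ.+ ε ℚ.≤_) (partialSum-∷ʳ-0 ks 1 n)
          (h (suc n) (ℕP.m≤n⇒m≤1+n (ℕP.≤-trans (ℕP.m≤m⊔n N M) N⊔M≤n))))))

-- A vector ks of exponents starts the expansion of α when ζ⋆(ks) ≤ α but some
-- ζ⋆(ks, 1, …, 1) exceeds α.  Expanding up to depth i takes finitely many
-- case distinctions, so no choice is needed to do it under a double negation.
∉⇒Inf : ∀ {α} → 1ℝ < α → α ∉ 𝒵⋆ → Inf (Close α)
∉⇒Inf {α} 1<α α∉𝒵⋆ (i , far) = next-digit {x = seq α} (cauchy α) [] (≺harmonic {seq α} (cauchy α))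
  -- The empty vector has sum 1, so 1 < α is the assumption that `next-digit` refutes for the empty
  -- stem.
  (λ c α⊀ overshoot → expand i (stem-∷ʳ [] c) (ℕP.m≤m+n i 1) α⊀ overshoot) 1<α
  where
  -- No value of depth at least i is close, so by `⊀-∷ʳ1` each further 1 keeps the sum from
  -- exceeding α.
  all-ones : ∀ j {r} {ks : Vec ℕ r} → Admissible ks → i ℕ.≤ r → ¬ (seq α ≺ partialSum 0 ks) →
    ¬ (seq α ≺ nested (ones j) ks)
  all-ones zero    {ks = ks} adm i≤r α⊀ α≺ = α⊀ (≺-respʳ {x = seq α} (λ n → sym (partialSum≡nested ks n)) α≺)
  all-ones (suc j) {ks = ks} adm i≤r α⊀ α≺ = all-ones j (Admissible-∷ʳ1 adm) (ℕP.m≤n⇒m≤1+n i≤r)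
    (⊀-∷ʳ1 {α} adm (λ close → far _ i≤r (ks , adm , close)) α⊀)
    (≺-respʳ {x = seq α} (λ n → sym (nested-ones-∷ʳ j ks n)) α≺)

  -- Induction on the number m of exponents missing up to depth i. If the next exponent is 1, the
  -- hypothesis for `ks ∷ʳ 1` applies. If it is larger, the hypothesis and `next-digit` exclude that
  -- α exceeds the star value of `ks`, so the two are equal, against α ∉ `𝒵⋆`.
  expand : ∀ m {r} {ks : Vec ℕ r} → Admissible ks → i ℕ.≤ m ℕ.+ r → ¬ (seq α ≺ partialSum 0 ks) →
    ¬ ¬ (∀ j → ¬ (seq α ≺ nested (ones j) ks))
  expand zero    adm i≤r α⊀ overshoot = overshoot λ j → all-ones j adm i≤r α⊀
  expand (suc m) {r} {ks} adm i≤m+r α⊀ overshoot = digit-1 λ α≺1 →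
    α∉𝒵⋆ (_ , ks , adm , ⊀⊁⇒≃ {α} {ζ⋆ ks adm} α⊀
      (next-digit {x = seq α} (cauchy α) (stem adm) α≺1 λ c → expand m (stem-∷ʳ (stem adm) c) i≤m+r′))
    where
    i≤m+r′ : i ℕ.≤ m ℕ.+ suc r
    i≤m+r′ = subst (i ℕ.≤_) (sym (ℕP.+-suc m r)) i≤m+r
    digit-1 : ¬ ¬ (seq α ≺ partialSum 0 (ks ∷ʳ 1))
    digit-1 α⊀1 = expand m (Admissible-∷ʳ1 adm) i≤m+r′ α⊀1 λ none → overshoot λ where
      zero    α≺ → α⊀ (≺-respʳ {x = seq α} (λ n → sym (partialSum≡nested ks n)) α≺)
      (suc j) α≺ → none j (≺-respʳ {x = seq α} (λ n → sym (nested-ones-∷ʳ j ks n)) α≺)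

theorem1p1 : (α : ℝ) → 1ℝ < α →
    (α ∉ 𝒵⋆) ⇔
    Inf (λ r → Σ[ k ∈ Vec ℕ r ] Σ[ adm ∈ Admissible k ] ∣ α - ζ⋆ k adm ∣ < gap k adm)
theorem1p1 α 1<α = mk⇔ (∉⇒Inf {α} 1<α) λ inf α∈𝒵⋆ →
  let _ , _ , adm , α≃ζ = α∈𝒵⋆ in inf (∈⇒Fin {α} adm α≃ζ)
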